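{- Let $q$ be a prime power and let $g_{2,\delta}(x)=\delta x^{q^2}+x^{q^3}$ for some $\delta\in \mathbb{F}_{q^5}^*$ with $\mathrm{N}(\delta)^5 \neq 1$. Then the linear set $L_{g_{2,\delta}}$ of $\mathrm{PG}(1,q^5)$ is not $\mathrm{P\Gamma L}(2,q^5)$-equivalent to any linear set $L_{g_{1,\mu}}$, where $g_{1,\mu}(x)=\mu x^{q}+x^{q^4}$ with $\mu\in\mathbb{F}_{q^5}^*$ and $\mathrm{N}(\mu)\notin\{0,1\}$.
   Context: $\mathrm{N}(x)=x^{1+q+q^2+q^3+q^4}$ is the norm from $\mathbb{F}_{q^5}$ to $\mathbb{F}_q$. For a $q$-polynomial $f$ over $\mathbb{F}_{q^5}$, $L_f=\{\langle (x,f(x))\rangle_{\mathbb{F}_{q^5}} : x\in\mathbb{F}_{q^5}^*\}\subseteq\mathrm{PG}(1,q^5)$. Two point sets of $\mathrm{PG}(1,q^5)$ are $\mathrm{P\Gamma L}(2,q^5)$-equivalent if some element of $\mathrm{P\Gamma L}(2,q^5)$ maps one onto the other. -}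

module Defs where

open import Level using (0ℓ)
open import Data.Nat as ℕ using (ℕ; zero; suc)
open import Data.Fin using (Fin)
open import Data.Product using (Σ; ∃; _×_; _,_)
open import Relation.Nullary using (¬_)
open import Relation.Binary.PropositionalEquality using (_≡_)
open import Function.Bundles using (_↔_)
open import Function.Definitions using (Injective; Surjective)
open import Algebra.Structures using (IsCommutativeRing)

record FiniteField : Set₁ where
  infixl 6 _+_
  infixl 7 _*_
  field
    Carrier : Set
    _+_ _*_ : Carrier → Carrier → Carrier
    -_      : Carrier → Carrier
    0# 1#   : Carrier
    isCommutativeRing : IsCommutativeRing _≡_ _+_ _*_ -_ 0# 1#
    0≢1     : ¬ (0# ≡ 1#)
    inverse : ∀ x → ¬ (x ≡ 0#) → ∃ λ y → x * y ≡ 1#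
    size    : ℕ
    enum    : Carrier ↔ Fin size

module _ (F : FiniteField) where
  open FiniteField F

  pow : Carrier → ℕ → Carrier
  pow x zero    = 1#
  pow x (suc n) = x * pow x n

  -- Norm from F_{q^5} to F_q : N(x) = x^(1+q+q^2+q^3+q^4)
  Norm : ℕ → Carrier → Carrier
  Norm q x = pow x (1 ℕ.+ q ℕ.+ q ℕ.^ 2 ℕ.+ q ℕ.^ 3 ℕ.+ q ℕ.^ 4)

  g2 : ℕ → Carrier → Carrier → Carrier
  g2 q δ x = δ * pow x (q ℕ.^ 2) + pow x (q ℕ.^ 3)

  g1 : ℕ → Carrier → Carrier → Carrier
  g1 q μ x = μ * pow x q + pow x (q ℕ.^ 4)

  Vec2 : Set
  Vec2 = Carrier × Carrier

  SamePoint : Vec2 → Vec2 → Set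
  SamePoint (a , b) (c , d) = Σ Carrier λ l → ¬ (l ≡ 0#) × (a ≡ l * c) × (b ≡ l * d)

  -- membership of (a vector representing) a point in L_f = {⟨(x, f x)⟩ : x ≠ 0}
  InL : (Carrier → Carrier) → Vec2 → Set
  InL f v = Σ Carrier λ x → ¬ (x ≡ 0#) × SamePoint v (x , f x)

  record FieldAut : Set where
    field
      σ      : Carrier → Carrier
      σ-+    : ∀ x y → σ (x + y) ≡ σ x + σ y
      σ-*    : ∀ x y → σ (x * y) ≡ σ x * σ y
      σ-1    : σ 1# ≡ 1#
      σ-inj  : Injective _≡_ _≡_ σ
      σ-surj : Surjective _≡_ _≡_ σ

  record PΓL2 : Set where
    field
      a b c d : Carrier
      det≢0   : ¬ (a * d + - (b * c) ≡ 0#)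
      aut     : FieldAut

    act : Vec2 → Vec2
    act (x , y) = let s = FieldAut.σ aut in
                  (a * s x + b * s y , c * s x + d * s y)

  PΓL-Equivalent : (Carrier → Carrier) → (Carrier → Carrier) → Set
  PΓL-Equivalent f h = Σ PΓL2 λ φ →
      (∀ v → InL f v → InL h (PΓL2.act φ v))
    × (∀ w → InL h w → Σ Vec2 λ v → InL f v × SamePoint (PΓL2.act φ v) w)

{-# OPTIONS --safe #-}
module Submission where

-- Write φ for x ↦ x^q on F_{q^5} and ev b x = ∑ᵢ bᵢ φⁱ(x). The nonempty fibres of x ↦ h(x)/x, for h = ev b and
-- x ≠ 0, are kernels minus 0, so their sizes are −1 in F; hence ∑_{x≠0} Ψ(h(x)/x) depends only on the point set
-- L_h, for every Ψ with Ψ(0) = 0. Taking Ψ(m) = m, m φ(m), m φ²(m), m φ(m) φ²(m), these sums are polynomials in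
-- the bᵢ, and L_h = L_{g₁,μ} forces h to be a binomial b₁ φ + b₄ φ⁴ as well. If a collineation maps L_{g₂,δ} onto
-- L_{g₁,μ}, it maps the graph of g₂,σ(δ) onto the graph of such an h: c x + d g₂(x) = h(a x + b g₂(x)).
-- Comparing the coefficients of the two sides gives N(σ δ) = 1, hence N(δ) = 1, which is excluded.

open import Defs
open import Algebra.Bundles using (CommutativeRing; CommutativeMonoid)
open import Data.Bool using (if_then_else_)
open import Data.Fin as Fin using (Fin; zero; suc; toℕ; fromℕ; inject₁; inject≤)
open import Data.Fin.Patterns using (0F; 1F; 2F; 3F; 4F)
import Data.Fin.Permutation as Perm
import Data.Fin.Properties as Fin
open import Data.Nat as ℕ using (ℕ; zero; suc; _^_; _≥_)
open import Data.Nat.Combinatorics using (_C_; nCn≡1; nCk≡n!/k![n-k]!; k![n∸k]!∣n!)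
open import Data.Nat.DivMod using (m/n*n≡m)
open import Data.Nat.Divisibility using (_∣_; divides; ∣⇒≤; m∣m*n)
open import Data.Nat.GeneralisedArithmetic using (fold-+) renaming (fold to ℕ-fold)
open import Data.Nat.Primality using (Prime; euclidsLemma; prime⇒nonTrivial; ¬prime[0])
import Data.Nat.Properties as ℕ
open import Data.Product using (Σ; ∃; _×_; _,_; proj₁; proj₂)
open import Data.Sum using (inj₁; inj₂)
open import Data.Vec using (Vec; []; _∷_; replicate)
open import Function using (_∘_; case_of_; _⇔_; mk⇔; Inverse; Injective)
open import Function.Bundles using (Equivalence)
open import Level using (0ℓ)
open import Relation.Binary.Definitions using (tri<; tri≈; tri>; DecidableEquality)
open import Relation.Binary.PropositionalEquality
open import Relation.Nullary using (¬_; Dec; yes; no; does; contradiction)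
open import Relation.Nullary.Decidable using (map′; decidable-stable; dec-true; dec-false; ¬?; _×-dec_)

-- Equal point sets do not force equal graphs: λ⁻¹ h(λ x) has the same slopes as h, so h can be
-- constrained only through invariants of the set of values h(x)/x. For Ψ(m) = m φ(m) φ²(m),
-- possibly with one or both of the last two factors dropped, the summand at x ≠ 0 is a product of
-- three linearized polynomials divided by x φ(x) φ²(x), and the sum is minus the coefficient of x
-- φ(x) φ²(x) in that product. The four choices yield b₀ and, once b₀ = 0, b₁ φ(b₄), b₂ φ²(b₃) and
-- b₁ φ(b₁) φ²(b₃) + b₂ φ(b₄) φ²(b₄). For g₁,μ these are 0, μ, 0, 0, and μ ≠ 0 leaves only b₁ and
-- b₄. The coefficient is isolated by orthogonality and polarization instead of by comparing base-q
-- digits, so that small q need no separate treatment. The map h exists because no L_g contains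
-- ⟨(0,1)⟩: hence x ↦ a x + b g₂(x) is injective, and its inverse on the finite field is one of its
-- iterates, again linearized.

prime∤! : ∀ {p} → Prime p → ∀ {n} → n ℕ.< p → ¬ (p ∣ n ℕ.!)
prime∤! pp {zero} n<p p∣1 = ℕ.<⇒≱ (ℕ.nonTrivial⇒n>1 _ {{prime⇒nonTrivial pp}}) (∣⇒≤ p∣1)
prime∤! pp {suc n} n<p p∣ with euclidsLemma (suc n) (n ℕ.!) pp p∣
... | inj₁ p∣n = ℕ.<⇒≱ n<p (∣⇒≤ p∣n)
... | inj₂ p∣n! = prime∤! pp (ℕ.<-trans (ℕ.n<1+n n) n<p) p∣n!

-- p divides p! = (p C k) · k! · (p - k)!, and both factorials on the right are products of factors
-- below p.
prime∣C : ∀ {p} → Prime p → ∀ {k} → 0 ℕ.< k → k ℕ.< p → p ∣ p C k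
prime∣C {p@(suc p-1)} pp {k} 0<k k<p
  with euclidsLemma (p C k) (k ℕ.! ℕ.* (p ℕ.∸ k) ℕ.!) pp
         (subst (p ∣_) (sym C*≡!) (m∣m*n (p-1 ℕ.!)))
  where
  instance _ = k ℕ.!* (p ℕ.∸ k) !≢0
  C*≡! : (p C k) ℕ.* (k ℕ.! ℕ.* (p ℕ.∸ k) ℕ.!) ≡ p ℕ.!
  C*≡! = trans (cong (ℕ._* (k ℕ.! ℕ.* (p ℕ.∸ k) ℕ.!)) (nCk≡n!/k![n-k]! (ℕ.<⇒≤ k<p)))
               (m/n*n≡m (k![n∸k]!∣n! (ℕ.<⇒≤ k<p)))
... | inj₁ p∣C = p∣C
... | inj₂ p∣! with euclidsLemma (k ℕ.!) ((p ℕ.∸ k) ℕ.!) pp p∣!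
...   | inj₁ p∣k! = contradiction p∣k! (prime∤! pp k<p)
...   | inj₂ p∣p-k! = contradiction p∣p-k! (prime∤! pp (ℕ.∸-monoʳ-< 0<k (ℕ.<⇒≤ k<p)))

-- Finite fields

module FiniteFieldProperties (F : FiniteField) where
  open FiniteField F

  commutativeRing : CommutativeRing 0ℓ 0ℓ
  commutativeRing = record { isCommutativeRing = isCommutativeRing }

  open CommutativeRing commutativeRing public
    using ( +-comm; +-assoc; +-identityˡ; +-identityʳ; -‿inverseˡ; -‿inverseʳ
          ; *-comm; *-assoc; *-identityˡ; *-identityʳ; distribˡ; distribʳ; zeroˡ; zeroʳ
          ; ring; semiring; commutativeSemiring; +-commutativeMonoid; *-commutativeMonoid; *-monoid)
  open import Algebra.Properties.Ring ring public
    using (-‿+-comm; -‿distribˡ-*; -‿distribʳ-*; x+x≈x⇒x≈0; +-cancelˡ; +-cancelʳ; +-inverseˡ-unique; x∙y⁻¹≈ε⇒x≈y)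
  open import Algebra.Properties.Semiring.Sum semiring public
    using (sum; sum-cong-≗; sum-init-last; sum-replicate; sum-replicate-zero; ∑-distrib-+; ∑-comm;
           *-distribˡ-sum; *-distribʳ-sum)
  open import Algebra.Properties.Semiring.Mult semiring public
    using (×1-homo-*; ×-assoc-*) renaming (_×_ to _⊗_)
  open import Algebra.Properties.Semiring.Exp semiring public
    using (^-assocʳ) renaming (_^_ to _^F_)
  open import Algebra.Properties.CommutativeMonoid.Sum *-commutativeMonoid public
    using () renaming (∑-distrib-+ to product-distrib)
  open import Algebra.Properties.CommutativeSemiring.Binomial commutativeSemiring public
    using (binomialTerm) renaming (theorem to binomial-theorem)
  open import Algebra.Solver.Ring.NaturalCoefficients.Default commutativeSemiring public
    using (solve; con; _:=_; _:+_; _:*_)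
  open import Algebra.Properties.Monoid.Sum *-monoid public
    using () renaming (sum to product; sum-replicate to product-replicate)
  open Inverse enum public using (to; from; strictlyInverseˡ; strictlyInverseʳ)
  open ≡-Reasoning

  infix 4 _≟_
  _≟_ : DecidableEquality Carrier
  x ≟ y = map′ (λ e → trans (sym (strictlyInverseʳ x)) (trans (cong from e) (strictlyInverseʳ y)))
               (cong to) (to x Fin.≟ to y)

  from-injective : Injective _≡_ _≡_ from
  from-injective {i} {j} e = trans (sym (strictlyInverseˡ i)) (trans (cong to e) (strictlyInverseˡ j))

  infix 9 _⁻¹

  opaque
    _⁻¹ : Carrier → Carrier
    x ⁻¹ with x ≟ 0#
    ... | yes _ = 0#
    ... | no x≢0 = proj₁ (inverse x x≢0)

    x*x⁻¹≡1 : ∀ {x} → ¬ x ≡ 0# → x * x ⁻¹ ≡ 1#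
    x*x⁻¹≡1 {x} x≢0 with x ≟ 0#
    ... | yes x≡0 = contradiction x≡0 x≢0
    ... | no x≢0 = proj₂ (inverse x x≢0)

    0⁻¹≡0 : 0# ⁻¹ ≡ 0#
    0⁻¹≡0 with 0# ≟ 0#
    ... | yes _ = refl
    ... | no 0≢0 = contradiction refl 0≢0

  *-cancelˡ : ∀ {x} → ¬ x ≡ 0# → ∀ {y z} → x * y ≡ x * z → y ≡ z
  *-cancelˡ {x} x≢0 {y} {z} e = begin
    y                ≡⟨ lemma y ⟨
    x ⁻¹ * (x * y)   ≡⟨ cong (x ⁻¹ *_) e ⟩
    x ⁻¹ * (x * z)   ≡⟨ lemma z ⟩
    z                ∎
    where
    lemma : ∀ w → x ⁻¹ * (x * w) ≡ w
    lemma w = begin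
      x ⁻¹ * (x * w)   ≡⟨ solve 3 (λ a b c → a :* (b :* c) := (b :* a) :* c) refl (x ⁻¹) x w ⟩
      (x * x ⁻¹) * w   ≡⟨ cong (_* w) (x*x⁻¹≡1 x≢0) ⟩
      1# * w           ≡⟨ *-identityˡ w ⟩
      w                ∎

  *-cancelʳ : ∀ {x} → ¬ x ≡ 0# → ∀ {y z} → y * x ≡ z * x → y ≡ z
  *-cancelʳ {x} x≢0 {y} {z} e = *-cancelˡ x≢0 (trans (*-comm x y) (trans e (*-comm z x)))

  xy≡0⇒y≡0 : ∀ {x y} → ¬ x ≡ 0# → x * y ≡ 0# → y ≡ 0#
  xy≡0⇒y≡0 {x} x≢0 e = *-cancelˡ x≢0 (trans e (sym (zeroʳ x)))

  *-≢0 : ∀ {x y} → ¬ x ≡ 0# → ¬ y ≡ 0# → ¬ x * y ≡ 0#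
  *-≢0 x≢0 y≢0 = y≢0 ∘ xy≡0⇒y≡0 x≢0

  xy≢0⇒x≢0 : ∀ {x y} → ¬ x * y ≡ 0# → ¬ x ≡ 0#
  xy≢0⇒x≢0 {y = y} xy≢0 refl = xy≢0 (zeroˡ y)

  xy≢0⇒y≢0 : ∀ {x y} → ¬ x * y ≡ 0# → ¬ y ≡ 0#
  xy≢0⇒y≢0 {x} xy≢0 refl = xy≢0 (zeroʳ x)

  -- Sums and products over all field elements

  module Fold (M : CommutativeMonoid 0ℓ 0ℓ) where
    open CommutativeMonoid M renaming (Carrier to A; setoid to A-setoid; refl to ≈-refl; trans to ≈-trans)
    import Algebra.Properties.CommutativeMonoid.Sum M as M

    sum-single : ∀ {n} (k : Fin n) y → M.sum (λ i → if does (i Fin.≟ k) then y else ε) ≈ y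
    sum-single {suc n} zero y = ≈-trans (∙-congˡ (M.sum-replicate-zero n)) (identityʳ y)
    sum-single {suc n} (suc k) y = ≈-trans (identityˡ _) (sum-single k y)

    -- Opaque, so that unification can read f off fold f.
    opaque
      fold : (Carrier → A) → A
      fold f = M.sum (f ∘ from)

      fold-cong : ∀ {f g} → (∀ x → f x ≈ g x) → fold f ≈ fold g
      fold-cong e = M.sum-cong-≋ (e ∘ from)

      fold-bijection : ∀ (f : Carrier → A) {s t : Carrier → Carrier} →
                       (∀ x → s (t x) ≡ x) → (∀ x → t (s x) ≡ x) → fold f ≈ fold (f ∘ s)
      fold-bijection f {s} {t} st ts = ≈-trans
        (M.sum-permute (f ∘ from) (Perm.permutation (conj s) (conj t) (conj-inverse s t st) (conj-inverse t s ts)))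
        (M.sum-cong-≋ λ i → reflexive (cong f (strictlyInverseʳ (s (from i)))))
        where
        conj : (Carrier → Carrier) → Fin size → Fin size
        conj h i = to (h (from i))
        conj-inverse : ∀ h k → (∀ x → h (k x) ≡ x) → ∀ i → conj h (conj k i) ≡ i
        conj-inverse h k e i = begin
          to (h (from (to (k (from i)))))   ≡⟨ cong (to ∘ h) (strictlyInverseʳ _) ⟩
          to (h (k (from i)))               ≡⟨ cong to (e (from i)) ⟩
          to (from i)                       ≡⟨ strictlyInverseˡ i ⟩
          i                                 ∎

      fold-single : ∀ a y → fold (λ x → if does (x ≟ a) then y else ε) ≈ y
      fold-single a y = ≈-trans
        (M.sum-cong-≋ λ i → reflexive (cong (λ j → if does (j Fin.≟ to a) then y else ε) (strictlyInverseˡ i)))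
        (sum-single (to a) y)

  open Fold +-commutativeMonoid public renaming
    (fold to ∑; fold-cong to ∑-cong; fold-bijection to ∑-bijection; fold-single to ∑-single)
  module Π = Fold *-commutativeMonoid

  opaque
    unfolding ∑

    ∑-+ : ∀ f g → ∑ (λ x → f x + g x) ≡ ∑ f + ∑ g
    ∑-+ f g = ∑-distrib-+ (f ∘ from) (g ∘ from)

    ∑-* : ∀ c f → ∑ (λ x → c * f x) ≡ c * ∑ f
    ∑-* c f = sym (*-distribˡ-sum c (f ∘ from))

    ∑-swap : ∀ (f : Carrier → Carrier → Carrier) → ∑ (λ x → ∑ (f x)) ≡ ∑ (λ y → ∑ (λ x → f x y))
    ∑-swap f = ∑-comm (λ i j → f (from i) (from j))

    ∑1≡size : ∑ (λ _ → 1#) ≡ size ⊗ 1#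
    ∑1≡size = sum-replicate size

  ∑-translate : ∀ f u → ∑ f ≡ ∑ (λ x → f (x + u))
  ∑-translate f u = ∑-bijection f {_+ u} {_+ (- u)}
    (λ x → cancel x (-‿inverseˡ u)) (λ x → cancel x (-‿inverseʳ u))
    where
    cancel : ∀ x {a b} → a + b ≡ 0# → x + a + b ≡ x
    cancel x {a} {b} e = trans (+-assoc x a b) (trans (cong (x +_) e) (+-identityʳ x))

  ∑-dilate : ∀ f {u} → ¬ u ≡ 0# → ∑ f ≡ ∑ (λ x → f (u * x))
  ∑-dilate f {u} u≢0 = ∑-bijection f {u *_} {u ⁻¹ *_}
    (λ x → cancel x (x*x⁻¹≡1 u≢0)) (λ x → cancel x (trans (*-comm _ u) (x*x⁻¹≡1 u≢0)))
    where
    cancel : ∀ x {a b} → a * b ≡ 1# → a * (b * x) ≡ x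
    cancel x {a} {b} e = trans (sym (*-assoc a b x)) (trans (cong (_* x) e) (*-identityˡ x))

  if-yes : ∀ {P : Set} (d : Dec P) {a b : Carrier} → P → (if does d then a else b) ≡ a
  if-yes d p = cong (λ t → if t then _ else _) (dec-true d p)

  if-no : ∀ {P : Set} (d : Dec P) {a b : Carrier} → ¬ P → (if does d then a else b) ≡ b
  if-no d ¬p = cong (λ t → if t then _ else _) (dec-false d ¬p)

  ⟦_⟧ : {P : Set} → Dec P → Carrier
  ⟦ d ⟧ = if does d then 1# else 0#

  ⟦⟧-cong : ∀ {P Q : Set} (d : Dec P) (e : Dec Q) → P ⇔ Q → ⟦ d ⟧ ≡ ⟦ e ⟧
  ⟦⟧-cong (yes p) e eq = sym (if-yes e (Equivalence.to eq p))
  ⟦⟧-cong (no ¬p) e eq = sym (if-no e (¬p ∘ Equivalence.from eq))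

  ⟦⟧*-cong : ∀ {P : Set} (d : Dec P) {x y} → (P → x ≡ y) → ⟦ d ⟧ * x ≡ ⟦ d ⟧ * y
  ⟦⟧*-cong (yes p) e = cong (1# *_) (e p)
  ⟦⟧*-cong (no _) {x} {y} _ = trans (zeroˡ x) (sym (zeroˡ y))

  ∑-⟦≟⟧ : ∀ a → ∑ (λ x → ⟦ x ≟ a ⟧) ≡ 1#
  ∑-⟦≟⟧ a = ∑-single a 1#

  ∑-pick : ∀ a f → ∑ (λ x → ⟦ x ≟ a ⟧ * f x) ≡ f a
  ∑-pick a f = begin
    ∑ (λ x → ⟦ x ≟ a ⟧ * f x)   ≡⟨ ∑-cong (λ x → ⟦⟧*-cong (x ≟ a) (cong f)) ⟩
    ∑ (λ x → ⟦ x ≟ a ⟧ * f a)   ≡⟨ ∑-cong (λ x → *-comm _ (f a)) ⟩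
    ∑ (λ x → f a * ⟦ x ≟ a ⟧)   ≡⟨ ∑-* (f a) _ ⟩
    f a * ∑ (λ x → ⟦ x ≟ a ⟧)   ≡⟨ cong (f a *_) (∑-⟦≟⟧ a) ⟩
    f a * 1#                    ≡⟨ *-identityʳ _ ⟩
    f a                         ∎

  -- Translating ∑_{x ∈ P} x by u changes it by u times the number of elements of P.
  count-invariant : ∀ {P : Carrier → Set} (P? : ∀ x → Dec (P x)) u → ¬ u ≡ 0# →
                    (∀ x → P x ⇔ P (x + u)) → ∑ (λ x → ⟦ P? x ⟧) ≡ 0#
  count-invariant P? u u≢0 inv = xy≡0⇒y≡0 u≢0 (+-cancelˡ (∑ (λ x → ⟦ P? x ⟧ * x)) _ _ (begin
    ∑ (λ x → ⟦ P? x ⟧ * x) + u * ∑ (λ x → ⟦ P? x ⟧)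
      ≡⟨ cong (_ +_) (∑-* u _) ⟨
    ∑ (λ x → ⟦ P? x ⟧ * x) + ∑ (λ x → u * ⟦ P? x ⟧)
      ≡⟨ ∑-+ _ _ ⟨
    ∑ (λ x → ⟦ P? x ⟧ * x + u * ⟦ P? x ⟧)
      ≡⟨ ∑-cong (λ x → solve 3 (λ a b c → a :* b :+ c :* a := a :* (b :+ c)) refl ⟦ P? x ⟧ x u) ⟩
    ∑ (λ x → ⟦ P? x ⟧ * (x + u))
      ≡⟨ ∑-cong (λ x → cong (_* (x + u)) (⟦⟧-cong (P? x) (P? (x + u)) (inv x))) ⟩
    ∑ (λ x → ⟦ P? (x + u) ⟧ * (x + u))
      ≡⟨ ∑-translate (λ x → ⟦ P? x ⟧ * x) u ⟨
    ∑ (λ x → ⟦ P? x ⟧ * x)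
      ≡⟨ +-identityʳ _ ⟨
    ∑ (λ x → ⟦ P? x ⟧ * x) + 0# ∎))

  ∑1≡0 : ∑ (λ _ → 1#) ≡ 0#
  ∑1≡0 = count-invariant (λ _ → yes (refl {x = 0#})) 1# (0≢1 ∘ sym) (λ x → mk⇔ (λ e → e) (λ e → e))

  size⊗1≡0 : size ⊗ 1# ≡ 0#
  size⊗1≡0 = trans (sym ∑1≡size) ∑1≡0

  -- Powers and polynomial roots

  pow≡^ : ∀ x n → pow F x n ≡ x ^F n
  pow≡^ x zero = refl
  pow≡^ x (suc n) = cong (x *_) (pow≡^ x n)

  pow-* : ∀ x m n → pow F x (m ℕ.* n) ≡ pow F (pow F x m) n
  pow-* x m n = begin
    pow F x (m ℕ.* n)   ≡⟨ pow≡^ x (m ℕ.* n) ⟩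
    x ^F (m ℕ.* n)      ≡⟨ ^-assocʳ x m n ⟨
    (x ^F m) ^F n       ≡⟨ cong (_^F n) (pow≡^ x m) ⟨
    pow F x m ^F n      ≡⟨ pow≡^ _ n ⟨
    pow F (pow F x m) n ∎

  pow-+ : ∀ x m n → pow F x (m ℕ.+ n) ≡ pow F x m * pow F x n
  pow-+ x zero n = sym (*-identityˡ _)
  pow-+ x (suc m) n = trans (cong (x *_) (pow-+ x m n)) (sym (*-assoc x _ _))

  pow-*-distrib : ∀ x y n → pow F (x * y) n ≡ pow F x n * pow F y n
  pow-*-distrib x y zero = sym (*-identityˡ 1#)
  pow-*-distrib x y (suc n) = trans (cong (x * y *_) (pow-*-distrib x y n))
    (solve 4 (λ a b c d → a :* b :* (c :* d) := a :* c :* (b :* d)) refl x y _ _)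

  pow-1 : ∀ n → pow F 1# n ≡ 1#
  pow-1 zero = refl
  pow-1 (suc n) = trans (*-identityˡ _) (pow-1 n)

  product≢0 : ∀ {n} (f : Fin n → Carrier) → (∀ i → ¬ f i ≡ 0#) →
              ¬ product f ≡ 0#
  product≢0 {zero} f f≢0 = 0≢1 ∘ sym
  product≢0 {suc n} f f≢0 = *-≢0 (f≢0 zero) (product≢0 (f ∘ suc) (f≢0 ∘ suc))

  opaque
    unfolding Fold.fold

    Π-* : ∀ f g → Π.fold (λ x → f x * g x) ≡ Π.fold f * Π.fold g
    Π-* f g = product-distrib (f ∘ from) (g ∘ from)

    Π-const : ∀ x → Π.fold (λ _ → x) ≡ pow F x size
    Π-const x = trans (product-replicate size) (sym (pow≡^ x size))

    Π≢0 : ∀ f → (∀ x → ¬ f x ≡ 0#) → ¬ Π.fold f ≡ 0#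
    Π≢0 f f≢0 = product≢0 (f ∘ from) (f≢0 ∘ from)

  pow-0 : ∀ {n} → 0 ℕ.< n → pow F 0# n ≡ 0#
  pow-0 {suc n} _ = zeroˡ _

  size>0 : 0 ℕ.< size
  size>0 = ℕ.≤-<-trans ℕ.z≤n (Fin.toℕ<n (to 0#))

  -- Multiplication by x ≠ 0 permutes the nonzero elements, so their product P satisfies x * P ≡ x ^ size * P.
  pow-size : ∀ x → pow F x size ≡ x
  pow-size x with x ≟ 0#
  ... | yes refl = pow-0 size>0
  ... | no x≢0 = sym (*-cancelʳ (Π≢0 orOne orOne≢0) (begin
    x * Π.fold orOne
      ≡⟨ cong (_* Π.fold orOne) (Π.fold-single 0# x) ⟨
    Π.fold (λ y → if does (y ≟ 0#) then x else 1#) * Π.fold orOne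
      ≡⟨ cong (Π.fold (λ y → if does (y ≟ 0#) then x else 1#) *_)
           (Π.fold-bijection orOne {x *_} {x ⁻¹ *_} (λ y → cancel y (x*x⁻¹≡1 x≢0))
                                (λ y → cancel y (trans (*-comm _ x) (x*x⁻¹≡1 x≢0)))) ⟩
    Π.fold (λ y → if does (y ≟ 0#) then x else 1#) * Π.fold (λ y → orOne (x * y))
      ≡⟨ Π-* _ _ ⟨
    Π.fold (λ y → (if does (y ≟ 0#) then x else 1#) * orOne (x * y))
      ≡⟨ Π.fold-cong orOne-* ⟩
    Π.fold (λ y → x * orOne y)
      ≡⟨ Π-* _ _ ⟩
    Π.fold (λ _ → x) * Π.fold orOne
      ≡⟨ cong (_* Π.fold orOne) (Π-const x) ⟩
    pow F x size * Π.fold orOne ∎))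
    where
    cancel : ∀ y {a b} → a * b ≡ 1# → a * (b * y) ≡ y
    cancel y {a} {b} e = trans (sym (*-assoc a b y)) (trans (cong (_* y) e) (*-identityˡ y))
    orOne : Carrier → Carrier
    orOne y = if does (y ≟ 0#) then 1# else y
    orOne≢0 : ∀ y → ¬ orOne y ≡ 0#
    orOne≢0 y e = case y ≟ 0# of λ where
      (yes y≡0) → 0≢1 (trans (sym e) (if-yes (y ≟ 0#) y≡0))
      (no y≢0) → y≢0 (trans (sym (if-no (y ≟ 0#) y≢0)) e)
    orOne-* : ∀ y → (if does (y ≟ 0#) then x else 1#) * orOne (x * y) ≡ x * orOne y
    orOne-* y = case y ≟ 0# of λ where
      (yes y≡0) → cong₂ _*_ (if-yes (y ≟ 0#) y≡0)
        (trans (if-yes (x * y ≟ 0#) (trans (cong (x *_) y≡0) (zeroʳ x))) (sym (if-yes (y ≟ 0#) y≡0)))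
      (no y≢0) → trans (cong₂ _*_ (if-no (y ≟ 0#) y≢0) (if-no (x * y ≟ 0#) (*-≢0 x≢0 y≢0)))
        (trans (*-identityˡ _) (cong (x *_) (sym (if-no (y ≟ 0#) y≢0))))

  -- The monic polynomial of degree n with the given lower coefficients, constant term first.
  eval : ∀ {n} → Vec Carrier n → Carrier → Carrier
  eval [] x = 1#
  eval (c ∷ cs) x = c + x * eval cs x

  -- Synthetic division by x - r: the coefficients are the Horner tails of the polynomial, evaluated
  -- at r.
  quotient : ∀ {n} → Vec Carrier (suc n) → Carrier → Vec Carrier n
  quotient (c ∷ []) r = []
  quotient (c ∷ cs@(_ ∷ _)) r = eval cs r ∷ quotient cs r

  -- eval cs x − eval cs r = (x − r) (eval (quotient cs r) x), without subtraction.
  quotient-correct : ∀ {n} (cs : Vec Carrier (suc n)) r x →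
    eval cs x + r * eval (quotient cs r) x ≡ eval cs r + x * eval (quotient cs r) x
  quotient-correct (c ∷ []) r x =
    solve 4 (λ c r x o → c :+ x :* o :+ r :* o := c :+ r :* o :+ x :* o) refl c r x 1#
  quotient-correct (c ∷ cs@(_ ∷ _)) r x = begin
    c + x * eval cs x + r * (eval cs r + x * e)
      ≡⟨ solve 6 (λ c x y r z e → c :+ x :* y :+ r :* (z :+ x :* e) := c :+ r :* z :+ x :* (y :+ r :* e))
           refl c x (eval cs x) r (eval cs r) e ⟩
    c + r * eval cs r + x * (eval cs x + r * e)
      ≡⟨ cong (λ t → c + r * eval cs r + x * t) (quotient-correct cs r x) ⟩
    c + r * eval cs r + x * (eval cs r + x * e) ∎
    where e = eval (quotient cs r) x

  -- Divide out the first root r and recurse: any other root differs from r and is therefore a root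
  -- of the quotient.
  degree≥roots : ∀ {n} (cs : Vec Carrier n) (roots : Fin (suc n) → Carrier) → Injective _≡_ _≡_ roots →
                 ¬ (∀ i → eval cs (roots i) ≡ 0#)
  degree≥roots [] roots inj allRoots = 0≢1 (sym (allRoots zero))
  degree≥roots cs@(_ ∷ _) roots inj allRoots =
    degree≥roots (quotient cs r) (roots ∘ suc) (Fin.suc-injective ∘ inj) λ i → quotient-root i _ refl
    where
    r = roots zero
    quotient-root : ∀ i y → y ≡ eval (quotient cs r) (roots (suc i)) → y ≡ 0#
    quotient-root i y refl with y ≟ 0#
    ... | yes y≡0 = y≡0
    ... | no y≢0 = contradiction (inj (*-cancelʳ y≢0 (begin
      r * y                                  ≡⟨ +-identityˡ _ ⟨
      0# + r * y                             ≡⟨ cong (_+ r * y) (allRoots (suc i)) ⟨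
      eval cs (roots (suc i)) + r * y        ≡⟨ quotient-correct cs r (roots (suc i)) ⟩
      eval cs r + roots (suc i) * y          ≡⟨ cong (_+ roots (suc i) * y) (allRoots zero) ⟩
      0# + roots (suc i) * y                 ≡⟨ +-identityˡ _ ⟩
      roots (suc i) * y                      ∎))) λ ()

  eval-replicate : ∀ n x → eval (replicate n 0#) x ≡ pow F x n
  eval-replicate zero x = refl
  eval-replicate (suc n) x = trans (+-identityˡ _) (cong (x *_) (eval-replicate n x))

  pow-distinct : ∀ {m n} → 0 ℕ.< m → m ℕ.< n → n ℕ.< size → ¬ (∀ x → pow F x m ≡ pow F x n)
  pow-distinct {m} 0<m m<n n<size e with d , refl ← ℕ.m≤n⇒∃[o]m+o≡n m<n =
    -- The polynomial x^(d+2) - x, where d + 1 = n - m. Its factor x makes 0 a root too, so every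
    -- field element is a root; 0 < m and n < size provide the d + 3 elements that are needed.
    degree≥roots (0# ∷ - 1# ∷ replicate d 0#) (from ∘ λ i → inject≤ i 2+d<size)
      (Fin.inject≤-injective _ _ _ _ ∘ from-injective) (root ∘ from ∘ λ i → inject≤ i 2+d<size)
    where
    2+d<size : 3 ℕ.+ d ℕ.≤ size
    2+d<size = ℕ.≤-trans (ℕ.s≤s (ℕ.s≤s (ℕ.+-monoˡ-≤ d 0<m))) n<size
    x^1+d≡1 : ∀ {x} → ¬ x ≡ 0# → x * pow F x d ≡ 1#
    x^1+d≡1 {x} x≢0 = *-cancelˡ (pow≢0 m) (begin
      pow F x m * (x * pow F x d)   ≡⟨ pow-+ x m (suc d) ⟨
      pow F x (m ℕ.+ suc d)         ≡⟨ cong (pow F x) (ℕ.+-suc m d) ⟩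
      pow F x (suc m ℕ.+ d)         ≡⟨ e x ⟨
      pow F x m                     ≡⟨ *-identityʳ _ ⟨
      pow F x m * 1#                ∎)
      where
      pow≢0 : ∀ k → ¬ pow F x k ≡ 0#
      pow≢0 zero = 0≢1 ∘ sym
      pow≢0 (suc k) = *-≢0 x≢0 (pow≢0 k)
    root : ∀ x → 0# + x * (- 1# + x * eval (replicate d 0#) x) ≡ 0#
    root x with x ≟ 0#
    ... | yes refl = trans (+-identityˡ _) (zeroˡ _)
    ... | no x≢0 = begin
      0# + x * (- 1# + x * eval (replicate d 0#) x)
        ≡⟨ cong (λ t → 0# + x * (- 1# + x * t)) (eval-replicate d x) ⟩
      0# + x * (- 1# + x * pow F x d)
        ≡⟨ cong (λ t → 0# + x * (- 1# + t)) (x^1+d≡1 x≢0) ⟩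
      0# + x * (- 1# + 1#)
        ≡⟨ cong (λ t → 0# + x * t) (-‿inverseˡ 1#) ⟩
      0# + x * 0#
        ≡⟨ trans (+-identityˡ _) (zeroʳ x) ⟩
      0# ∎

  -- There are only size ^ size self-maps, so two of the iterates T⁰, ..., T^(size^size) coincide;
  -- cancelling the smaller power by injectivity leaves T^(n+1) = id. An inverse of this form stays
  -- in every class of maps that contains T and the identity and is closed under composition.
  injective⇒iterate-inverse : ∀ {T : Carrier → Carrier} → Injective _≡_ _≡_ T →
                              ∃ λ n → ∀ x → T (ℕ-fold x T n) ≡ x
  injective⇒iterate-inverse {T} T-inj =
    let i , j , i<j , e = Fin.pigeonhole (ℕ.n<1+n (size ^ size)) code
        n , 1+i+n≡j = ℕ.m≤n⇒∃[o]m+o≡n i<j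
    in n , λ x → fold-injective (toℕ i) (begin
      ℕ-fold (ℕ-fold x T (suc n)) T (toℕ i)   ≡⟨ fold-+ x T (toℕ i) ⟨
      ℕ-fold x T (toℕ i ℕ.+ suc n)            ≡⟨ cong (ℕ-fold x T) (trans (ℕ.+-suc (toℕ i) n) 1+i+n≡j) ⟩
      ℕ-fold x T (toℕ j)                      ≡⟨ decode i j e x ⟨
      ℕ-fold x T (toℕ i)                      ∎)
    where
    power : Fin (suc (size ^ size)) → Fin size → Fin size
    power i s = to (ℕ-fold (from s) T (toℕ i))
    code : Fin (suc (size ^ size)) → Fin (size ^ size)
    code i = Fin.funToFin (power i)
    decode : ∀ i j → code i ≡ code j → ∀ x → ℕ-fold x T (toℕ i) ≡ ℕ-fold x T (toℕ j)
    decode i j e x = begin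
      ℕ-fold x T (toℕ i)              ≡⟨ power-correct i ⟨
      from (power i (to x))           ≡⟨ cong from (Fin.finToFun-funToFin (power i) (to x)) ⟨
      from (Fin.finToFun (code i) (to x))
                                      ≡⟨ cong (λ c → from (Fin.finToFun c (to x))) e ⟩
      from (Fin.finToFun (code j) (to x))
                                      ≡⟨ cong from (Fin.finToFun-funToFin (power j) (to x)) ⟩
      from (power j (to x))           ≡⟨ power-correct j ⟩
      ℕ-fold x T (toℕ j)              ∎
      where
      power-correct : ∀ i → from (power i (to x)) ≡ ℕ-fold x T (toℕ i)
      power-correct i = trans (strictlyInverseʳ _) (cong (λ y → ℕ-fold y T (toℕ i)) (strictlyInverseʳ x))
    fold-injective : ∀ m {x y} → ℕ-fold x T m ≡ ℕ-fold y T m → x ≡ y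
    fold-injective zero e = e
    fold-injective (suc m) e = fold-injective m (T-inj e)

  -- Characteristic p and additivity of x ↦ x^(p^k)

  module _ {p} (pp : Prime p) where

    -- Factors p ⊗ 1# can be cancelled as long as they are nonzero. Applied to the size of the
    -- field, this identifies the characteristic.
    ⊗1-^ : ∀ n → (p ^ n) ⊗ 1# ≡ 0# → p ⊗ 1# ≡ 0#
    ⊗1-^ zero e = contradiction (sym (trans (sym (+-identityʳ 1#)) e)) 0≢1
    ⊗1-^ (suc n) e with p ⊗ 1# ≟ 0#
    ... | yes p≡0 = p≡0
    ... | no p≢0 = ⊗1-^ n (xy≡0⇒y≡0 p≢0 (trans (sym (×1-homo-* p (p ^ n))) e))

    module _ (p⊗1≡0 : p ⊗ 1# ≡ 0#) where

      p∣⇒⊗≡0 : ∀ {n} → p ∣ n → ∀ x → n ⊗ x ≡ 0#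
      p∣⇒⊗≡0 (divides m refl) x = begin
        (m ℕ.* p) ⊗ x               ≡⟨ cong ((m ℕ.* p) ⊗_) (*-identityˡ x) ⟨
        (m ℕ.* p) ⊗ (1# * x)        ≡⟨ ×-assoc-* (m ℕ.* p) 1# x ⟨
        ((m ℕ.* p) ⊗ 1#) * x        ≡⟨ cong (_* x) (×1-homo-* m p) ⟩
        (m ⊗ 1#) * (p ⊗ 1#) * x     ≡⟨ cong (λ t → (m ⊗ 1#) * t * x) p⊗1≡0 ⟩
        (m ⊗ 1#) * 0# * x           ≡⟨ cong (_* x) (zeroʳ _) ⟩
        0# * x                      ≡⟨ zeroˡ x ⟩
        0#                          ∎

      pow-p-+ : ∀ x y → pow F (x + y) p ≡ pow F x p + pow F y p
      pow-p-+ x y = go p refl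
        where
        -- With p exposed as a successor suc n, the binomial sum splits into its first term, n
        -- middle terms, whose coefficients p divides, and its last term.
        go : ∀ n → n ≡ p → pow F (x + y) n ≡ pow F x n + pow F y n
        go zero refl = contradiction pp ¬prime[0]
        go (suc n) refl = begin
          pow F (x + y) p                                         ≡⟨ pow≡^ _ p ⟩
          (x + y) ^F p                                            ≡⟨ binomial-theorem p x y ⟩
          term zero + sum (term ∘ suc)                            ≡⟨ cong (term zero +_) (sum-init-last (term ∘ suc)) ⟩
          term zero + (sum (λ i → term (suc (inject₁ i))) + term (fromℕ p)) ≡⟨ cong₂ _+_ term₀ (cong₂ _+_ middle last) ⟩
          pow F y p + (0# + pow F x p)                            ≡⟨ cong (pow F y p +_) (+-identityˡ _) ⟩
          pow F y p + pow F x p                                   ≡⟨ +-comm _ _ ⟩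
          pow F x p + pow F y p                                   ∎
          where
          term = binomialTerm x y p
          term₀ : term zero ≡ pow F y p
          term₀ = trans (+-identityʳ _) (trans (*-identityˡ _) (sym (pow≡^ y p)))
          middle : sum (λ i → term (suc (inject₁ i))) ≡ 0#
          middle = trans (sum-cong-≗ λ i → p∣⇒⊗≡0 (prime∣C pp (ℕ.s≤s ℕ.z≤n)
                     (ℕ.s≤s (subst (ℕ._< n) (sym (Fin.toℕ-inject₁ i)) (Fin.toℕ<n i)))) _)
                     (sum-replicate-zero n)
          last : term (fromℕ p) ≡ pow F x p
          last = begin
            (p C toℕ (fromℕ p)) ⊗ (x ^F toℕ (fromℕ p) * y ^F (p ℕ.∸ toℕ (fromℕ p)))
              ≡⟨ cong (λ k → (p C k) ⊗ (x ^F k * y ^F (p ℕ.∸ k))) (Fin.toℕ-fromℕ p) ⟩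
            (p C p) ⊗ (x ^F p * y ^F (p ℕ.∸ p))
              ≡⟨ cong₂ (λ k l → k ⊗ (x ^F p * y ^F l)) (nCn≡1 p) (ℕ.n∸n≡0 p) ⟩
            x ^F p * 1# + 0#
              ≡⟨ trans (+-identityʳ _) (*-identityʳ _) ⟩
            x ^F p
              ≡⟨ pow≡^ x p ⟨
            pow F x p ∎

      pow-p^k-+ : ∀ k x y → pow F (x + y) (p ^ k) ≡ pow F x (p ^ k) + pow F y (p ^ k)
      pow-p^k-+ zero x y = trans (*-identityʳ _) (sym (cong₂ _+_ (*-identityʳ x) (*-identityʳ y)))
      pow-p^k-+ (suc k) x y = begin
        pow F (x + y) (p ^ suc k)                            ≡⟨ pow-* (x + y) p (p ^ k) ⟩
        pow F (pow F (x + y) p) (p ^ k)                      ≡⟨ cong (λ t → pow F t (p ^ k)) (pow-p-+ x y) ⟩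
        pow F (pow F x p + pow F y p) (p ^ k)                ≡⟨ pow-p^k-+ k _ _ ⟩
        pow F (pow F x p) (p ^ k) + pow F (pow F y p) (p ^ k) ≡⟨ cong₂ _+_ (pow-* x p (p ^ k)) (pow-* y p (p ^ k)) ⟨
        pow F x (p ^ suc k) + pow F y (p ^ suc k)            ∎

-- Linearized polynomials

-- Models x ↦ x^q. Working with iterates keeps the exponents qⁱ out of the algebra, and `φ-distinct`
-- is the source of the linear independence of the powers of φ.
record AutomorphismOfOrder5 (F : FiniteField) : Set where
  open FiniteField F
  field
    φ       : Carrier → Carrier
    φ-+     : ∀ x y → φ (x + y) ≡ φ x + φ y
    φ-*     : ∀ x y → φ (x * y) ≡ φ x * φ y
    φ-1     : φ 1# ≡ 1#
    φ-order : ∀ x → φ (φ (φ (φ (φ x)))) ≡ x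

  iterate : ℕ → Carrier → Carrier
  iterate n x = ℕ-fold x φ n

  field
    φ-distinct : ∀ {i j : Fin 5} → ¬ i ≡ j → ¬ (∀ x → iterate (toℕ i) x ≡ iterate (toℕ j) x)

module LinearizedPolynomials (F : FiniteField) (automorphism : AutomorphismOfOrder5 F) where
  open FiniteField F
  open AutomorphismOfOrder5 automorphism
  open FiniteFieldProperties F
  open ≡-Reasoning

  X : Fin 5 → Carrier → Carrier
  X i = iterate (toℕ i)

  X-+ : ∀ i x y → X i (x + y) ≡ X i x + X i y
  X-+ i = go (toℕ i)
    where
    go : ∀ n x y → iterate n (x + y) ≡ iterate n x + iterate n y
    go zero x y = refl
    go (suc n) x y = trans (cong φ (go n x y)) (φ-+ _ _)

  X-* : ∀ i x y → X i (x * y) ≡ X i x * X i y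
  X-* i = go (toℕ i)
    where
    go : ∀ n x y → iterate n (x * y) ≡ iterate n x * iterate n y
    go zero x y = refl
    go (suc n) x y = trans (cong φ (go n x y)) (φ-* _ _)

  X-1 : ∀ i → X i 1# ≡ 1#
  X-1 i = go (toℕ i)
    where
    go : ∀ n → iterate n 1# ≡ 1#
    go zero = refl
    go (suc n) = trans (cong φ (go n)) φ-1

  Additive : (Carrier → Carrier) → Set
  Additive f = ∀ x y → f (x + y) ≡ f x + f y

  additive-0 : ∀ {f} → Additive f → f 0# ≡ 0#
  additive-0 {f} f-+ = x+x≈x⇒x≈0 (f 0#) (trans (sym (f-+ 0# 0#)) (cong f (+-identityˡ 0#)))

  X-0 : ∀ i → X i 0# ≡ 0#
  X-0 i = additive-0 (X-+ i)

  X≢0 : ∀ i {x} → ¬ x ≡ 0# → ¬ X i x ≡ 0#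
  X≢0 i {x} x≢0 Xx≡0 = 0≢1 (begin
    0#                   ≡⟨ zeroˡ _ ⟨
    0# * X i (x ⁻¹)      ≡⟨ cong (_* X i (x ⁻¹)) Xx≡0 ⟨
    X i x * X i (x ⁻¹)   ≡⟨ X-* i x (x ⁻¹) ⟨
    X i (x * x ⁻¹)       ≡⟨ cong (X i) (x*x⁻¹≡1 x≢0) ⟩
    X i 1#               ≡⟨ X-1 i ⟩
    1#                   ∎)

  -- Orthogonality and independence of the powers of φ

  X-⁻¹ : ∀ i {x} → ¬ x ≡ 0# → X i x * X i (x ⁻¹) ≡ 1#
  X-⁻¹ i {x} x≢0 = trans (sym (X-* i x (x ⁻¹))) (trans (cong (X i) (x*x⁻¹≡1 x≢0)) (X-1 i))

  ⁻¹-* : ∀ {u} → ¬ u ≡ 0# → ∀ x → (u * x) ⁻¹ ≡ u ⁻¹ * x ⁻¹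
  ⁻¹-* {u} u≢0 x with x ≟ 0#
  ... | yes refl = trans (cong _⁻¹ (zeroʳ u)) (trans 0⁻¹≡0 (sym (trans (cong (u ⁻¹ *_) 0⁻¹≡0) (zeroʳ _))))
  ... | no x≢0 = *-cancelˡ (*-≢0 u≢0 x≢0) (begin
    u * x * (u * x) ⁻¹      ≡⟨ x*x⁻¹≡1 (*-≢0 u≢0 x≢0) ⟩
    1#                      ≡⟨ *-identityʳ 1# ⟨
    1# * 1#                 ≡⟨ cong₂ _*_ (x*x⁻¹≡1 u≢0) (x*x⁻¹≡1 x≢0) ⟨
    u * u ⁻¹ * (x * x ⁻¹)   ≡⟨ solve 4 (λ a b c d → a :* b :* (c :* d) := a :* c :* (b :* d)) refl u (u ⁻¹) x (x ⁻¹) ⟩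
    u * x * (u ⁻¹ * x ⁻¹)   ∎)

  -- `f x * g x` is the indicator of x ≠ 0, and the number of nonzero elements is -1 in F.
  ∑-pairing : ∀ (f g : Carrier → Carrier) → (∀ {x} → ¬ x ≡ 0# → f x * g x ≡ 1#) → g 0# ≡ 0# → - ∑ (λ x → f x * g x) ≡ 1#
  ∑-pairing f g fg≡1 g0≡0 = sym (+-inverseˡ-unique 1# (∑ (λ x → f x * g x)) (begin
    1# + ∑ (λ x → f x * g x)                     ≡⟨ cong (_+ ∑ (λ x → f x * g x)) (∑-⟦≟⟧ 0#) ⟨
    ∑ (λ x → ⟦ x ≟ 0# ⟧) + ∑ (λ x → f x * g x)   ≡⟨ ∑-+ _ _ ⟨
    ∑ (λ x → ⟦ x ≟ 0# ⟧ + f x * g x)             ≡⟨ ∑-cong (λ x → pointwise x (x ≟ 0#)) ⟩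
    ∑ (λ _ → 1#)                                 ≡⟨ ∑1≡0 ⟩
    0#                                           ∎))
    where
    pointwise : ∀ x (d : Dec (x ≡ 0#)) → ⟦ d ⟧ + f x * g x ≡ 1#
    pointwise x (yes refl) = trans (cong (λ t → 1# + f 0# * t) g0≡0) (trans (cong (1# +_) (zeroʳ _)) (+-identityʳ 1#))
    pointwise x (no x≢0) = trans (+-identityˡ _) (fg≡1 x≢0)

  -- Character orthogonality: replacing x by u x multiplies the sum by m u * w u, and w is the
  -- reciprocal of m' on nonzero elements. A nonzero sum thus forces m and m' to agree there.
  ∑-scaling : ∀ (m m' w : Carrier → Carrier) → (∀ {u} → ¬ u ≡ 0# → ∀ x → m (u * x) ≡ m u * m x) →
              (∀ {u} → ¬ u ≡ 0# → ∀ x → w (u * x) ≡ w u * w x) →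
              (∀ {u} → ¬ u ≡ 0# → m' u * w u ≡ 1#) →
              ∀ {u} → ¬ u ≡ 0# → ∑ (λ x → m x * w x) * m u ≡ ∑ (λ x → m x * w x) * m' u
  ∑-scaling m m' w m-* w-* m'w≡1 {u} u≢0 = sym (begin
    s * m' u
      ≡⟨ cong (_* m' u) (∑-dilate (λ x → m x * w x) u≢0) ⟩
    ∑ (λ x → m (u * x) * w (u * x)) * m' u
      ≡⟨ cong (_* m' u) (∑-cong λ x → trans (cong₂ _*_ (m-* u≢0 x) (w-* u≢0 x))
           (solve 4 (λ a b c d → a :* b :* (c :* d) := a :* c :* (b :* d)) refl (m u) (m x) (w u) (w x))) ⟩
    ∑ (λ x → m u * w u * (m x * w x)) * m' u
      ≡⟨ cong (_* m' u) (∑-* (m u * w u) _) ⟩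
    m u * w u * s * m' u
      ≡⟨ solve 4 (λ a b c d → a :* b :* c :* d := c :* a :* (d :* b)) refl (m u) (w u) s (m' u) ⟩
    s * m u * (m' u * w u)
      ≡⟨ trans (cong (s * m u *_) (m'w≡1 u≢0)) (*-identityʳ _) ⟩
    s * m u ∎)
    where s = ∑ (λ x → m x * w x)

  -- The functional dual to φᵏ: division by φᵏ(x) makes the term of index k constant on x ≠ 0, and
  -- the sign undoes the factor -1 from summing over those x.
  coefficient : Fin 5 → (Carrier → Carrier) → Carrier
  coefficient k f = - ∑ (λ x → f x * X k (x ⁻¹))

  -- For i ≠ k, a nonzero sum would by `∑-scaling` make φⁱ and φᵏ the same function, contrary to
  -- `φ-distinct`.
  coefficient-X : ∀ k i → coefficient k (X i) ≡ ⟦ i Fin.≟ k ⟧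
  coefficient-X k i with i Fin.≟ k
  ... | yes refl = ∑-pairing (X k) (λ x → X k (x ⁻¹)) (X-⁻¹ k) (trans (cong (X k) 0⁻¹≡0) (X-0 k))
  ... | no i≢k = trans (cong -_ s≡0) (sym (+-inverseˡ-unique 0# 0# (+-identityˡ 0#)))
    where
    s = ∑ (λ x → X i x * X k (x ⁻¹))
    s≡0 : s ≡ 0#
    s≡0 with s ≟ 0#
    ... | yes e = e
    ... | no s≢0 = contradiction
      (λ x → case x ≟ 0# of λ where
        (yes refl) → trans (X-0 i) (sym (X-0 k))
        (no x≢0) → *-cancelˡ s≢0 (∑-scaling (X i) (X k) (λ x → X k (x ⁻¹)) (λ _ → X-* i _)
          (λ u≢0 x → trans (cong (X k) (⁻¹-* u≢0 x)) (X-* k _ _)) (X-⁻¹ k) x≢0))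
      (φ-distinct i≢k)

  -- Used with the weight X k (x ⁻¹), which reads off the coefficient of X k, and with `ω`, which
  -- reads off the coefficient of X₀X₁X₂ in a product of three linearized polynomials.
  module LinearFunctional (w : Carrier → Carrier) where

    L : (Carrier → Carrier) → Carrier
    L f = - ∑ (λ x → f x * w x)

    L-cong : ∀ {f g} → (∀ x → f x ≡ g x) → L f ≡ L g
    L-cong e = cong -_ (∑-cong λ x → cong (_* w x) (e x))

    L-+ : ∀ f g → L (λ x → f x + g x) ≡ L f + L g
    L-+ f g = begin
      - ∑ (λ x → (f x + g x) * w x)                     ≡⟨ cong -_ (∑-cong λ x → distribʳ (w x) (f x) (g x)) ⟩
      - ∑ (λ x → f x * w x + g x * w x)                 ≡⟨ cong -_ (∑-+ _ _) ⟩
      - (∑ (λ x → f x * w x) + ∑ (λ x → g x * w x))     ≡⟨ -‿+-comm _ _ ⟨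
      L f + L g                                         ∎

    L-* : ∀ c f → L (λ x → c * f x) ≡ c * L f
    L-* c f = begin
      - ∑ (λ x → c * f x * w x)     ≡⟨ cong -_ (∑-cong λ x → *-assoc c (f x) (w x)) ⟩
      - ∑ (λ x → c * (f x * w x))   ≡⟨ cong -_ (∑-* c _) ⟩
      - (c * ∑ (λ x → f x * w x))   ≡⟨ -‿distribʳ-* c _ ⟩
      c * L f                       ∎

    L-sum : ∀ {n} (b : Fin n → Carrier) (f : Fin n → Carrier → Carrier) →
            L (λ x → sum (λ i → b i * f i x)) ≡ sum (λ i → b i * L (f i))
    L-sum {zero} b f = begin
      L (λ _ → 0#)          ≡⟨ L-cong (λ _ → sym (zeroˡ 0#)) ⟩
      L (λ _ → 0# * 0#)     ≡⟨ L-* 0# (λ _ → 0#) ⟩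
      0# * L (λ _ → 0#)     ≡⟨ zeroˡ _ ⟩
      0#                    ∎
    L-sum {suc n} b f = trans (L-+ _ _) (cong₂ _+_ (L-* (b zero) (f zero)) (L-sum (b ∘ suc) (f ∘ suc)))

  module Coefficient (k : Fin 5) = LinearFunctional (λ x → X k (x ⁻¹))

  -- Comparison of the coefficients of X k, in the shape that a permanent has as a linear function
  -- of its first row. The factor s is kept because it may vanish.
  extract : ∀ k s (i j l i' j' l' : Fin 5) {A B C A' B' C'} →
    (∀ x → s * (X i x * A + X j x * B + X l x * C) ≡ s * (X i' x * A' + X j' x * B' + X l' x * C')) →
    s * (⟦ i Fin.≟ k ⟧ * A + ⟦ j Fin.≟ k ⟧ * B + ⟦ l Fin.≟ k ⟧ * C) ≡
    s * (⟦ i' Fin.≟ k ⟧ * A' + ⟦ j' Fin.≟ k ⟧ * B' + ⟦ l' Fin.≟ k ⟧ * C')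
  extract k s i j l i' j' l' {A} {B} {C} {A'} {B'} {C'} e =
    trans (sym (lemma i j l A B C)) (trans (L-cong e) (lemma i' j' l' A' B' C'))
    where
    open Coefficient k
    term : ∀ i A → L (λ x → X i x * A) ≡ ⟦ i Fin.≟ k ⟧ * A
    term i A = begin
      L (λ x → X i x * A)    ≡⟨ L-cong (λ x → *-comm (X i x) A) ⟩
      L (λ x → A * X i x)    ≡⟨ L-* A (X i) ⟩
      A * L (X i)            ≡⟨ *-comm A _ ⟩
      L (X i) * A            ≡⟨ cong (_* A) (coefficient-X k i) ⟩
      ⟦ i Fin.≟ k ⟧ * A      ∎
    lemma : ∀ i j l A B C → L (λ x → s * (X i x * A + X j x * B + X l x * C)) ≡
            s * (⟦ i Fin.≟ k ⟧ * A + ⟦ j Fin.≟ k ⟧ * B + ⟦ l Fin.≟ k ⟧ * C)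
    lemma i j l A B C = trans (L-* s _) (cong (s *_) (trans (L-+ _ _)
      (cong₂ _+_ (trans (L-+ _ _) (cong₂ _+_ (term i A) (term j B))) (term l C))))

  -- The coefficient of X₀X₁X₂ in a product of three linearized polynomials

  ω : Carrier → Carrier
  ω x = X 0F (x ⁻¹) * X 1F (x ⁻¹) * X 2F (x ⁻¹)

  ω-* : ∀ {u} → ¬ u ≡ 0# → ∀ x → ω (u * x) ≡ ω u * ω x
  ω-* {u} u≢0 x = trans (cong (λ y → y * X 1F y * X 2F y) (⁻¹-* u≢0 x))
    (trans (cong₂ (λ y z → u ⁻¹ * x ⁻¹ * y * z) (X-* 1F _ _) (X-* 2F _ _))
      (solve 6 (λ a b c d e f → a :* b :* (c :* d) :* (e :* f) := a :* c :* e :* (b :* d :* f)) refl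
        (u ⁻¹) (x ⁻¹) (X 1F (u ⁻¹)) (X 1F (x ⁻¹)) (X 2F (u ⁻¹)) (X 2F (x ⁻¹))))

  ω-0 : ω 0# ≡ 0#
  ω-0 = trans (cong (λ y → y * X 1F (0# ⁻¹) * X 2F (0# ⁻¹)) 0⁻¹≡0) (trans (cong (_* X 2F (0# ⁻¹)) (zeroˡ _)) (zeroˡ _))

  ω-inverse : ∀ {x} → ¬ x ≡ 0# → X 0F x * X 1F x * X 2F x * ω x ≡ 1#
  ω-inverse {x} x≢0 = begin
    X 0F x * X 1F x * X 2F x * ω x
      ≡⟨ solve 6 (λ a b c d e f → a :* b :* c :* (d :* e :* f) := a :* d :* (b :* e) :* (c :* f)) refl
           (X 0F x) (X 1F x) (X 2F x) (X 0F (x ⁻¹)) (X 1F (x ⁻¹)) (X 2F (x ⁻¹)) ⟩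
    X 0F x * X 0F (x ⁻¹) * (X 1F x * X 1F (x ⁻¹)) * (X 2F x * X 2F (x ⁻¹))
      ≡⟨ cong₂ _*_ (cong₂ _*_ (X-⁻¹ 0F x≢0) (X-⁻¹ 1F x≢0)) (X-⁻¹ 2F x≢0) ⟩
    1# * 1# * 1#
      ≡⟨ trans (*-identityʳ _) (*-identityʳ 1#) ⟩
    1# ∎

  open LinearFunctional ω

  monomial : Fin 5 → Fin 5 → Fin 5 → Carrier → Carrier
  monomial i j l x = X i x * X j x * X l x

  -- Substituting u * x for x shows that S i j l ≢ 0 would make the monomials i j l and 0 1 2 agree as functions.
  -- Polarized, this contradicts the independence of the X i, unless {i, j, l} = {0, 1, 2}.
  S : Fin 5 → Fin 5 → Fin 5 → Carrier
  S i j l = L (monomial i j l)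

  monomial-* : ∀ i j l u x → monomial i j l (u * x) ≡ monomial i j l u * monomial i j l x
  monomial-* i j l u x = trans (cong₂ _*_ (cong₂ _*_ (X-* i u x) (X-* j u x)) (X-* l u x))
    (solve 6 (λ a b c d e f → a :* b :* (c :* d) :* (e :* f) := a :* c :* e :* (b :* d :* f)) refl _ _ _ _ _ _)

  monomial-0 : ∀ i j l → monomial i j l 0# ≡ 0#
  monomial-0 i j l = trans (cong (X i 0# * X j 0# *_) (X-0 l)) (zeroʳ _)

  S-monomial : ∀ i j l x → S i j l * monomial i j l x ≡ S i j l * monomial 0F 1F 2F x
  S-monomial i j l x with x ≟ 0#
  ... | yes refl = cong (S i j l *_) (trans (monomial-0 i j l) (sym (monomial-0 0F 1F 2F)))
  ... | no x≢0 = begin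
    - s * monomial i j l x          ≡⟨ -‿distribˡ-* s _ ⟨
    - (s * monomial i j l x)        ≡⟨ cong -_ (∑-scaling (monomial i j l) (monomial 0F 1F 2F) ω
                                         (λ _ → monomial-* i j l _) ω-* ω-inverse x≢0) ⟩
    - (s * monomial 0F 1F 2F x)     ≡⟨ -‿distribˡ-* s _ ⟩
    - s * monomial 0F 1F 2F x       ∎
    where s = ∑ (λ x → monomial i j l x * ω x)

  -- The symmetric trilinear form that polarizes the cubic `monomial i j l`, grouped by the factor
  -- containing w so that coefficients in w can be extracted.
  polar : Fin 5 → Fin 5 → Fin 5 → Carrier → Carrier → Carrier → Carrier
  polar i j l u v w =
      X i w * (X j v * X l u + X l v * X j u)
    + X j w * (X i v * X l u + X l v * X i u)
    + X l w * (X i v * X j u + X j v * X i u)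

  -- Inclusion-exclusion over the nonempty subsets of u, v, w, with the negative terms moved to the
  -- other side so that it is an identity of commutative semirings.
  polarization : ∀ i j l u v w →
    monomial i j l (u + v + w) + (monomial i j l u + monomial i j l v + monomial i j l w)
      ≡ polar i j l u v w + (monomial i j l (u + v) + monomial i j l (u + w) + monomial i j l (v + w))
  polarization i j l u v w
    rewrite X-+ i (u + v) w | X-+ j (u + v) w | X-+ l (u + v) w
          | X-+ i u v | X-+ j u v | X-+ l u v
          | X-+ i u w | X-+ j u w | X-+ l u w
          | X-+ i v w | X-+ j v w | X-+ l v w
    = solve 9 (λ iu ju lu iv jv lv iw jw lw →
        (iu :+ iv :+ iw) :* (ju :+ jv :+ jw) :* (lu :+ lv :+ lw)
          :+ (iu :* ju :* lu :+ iv :* jv :* lv :+ iw :* jw :* lw)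
        := iw :* (jv :* lu :+ lv :* ju) :+ jw :* (iv :* lu :+ lv :* iu) :+ lw :* (iv :* ju :+ jv :* iu)
          :+ ((iu :+ iv) :* (ju :+ jv) :* (lu :+ lv) :+ (iu :+ iw) :* (ju :+ jw) :* (lu :+ lw)
            :+ (iv :+ iw) :* (jv :+ jw) :* (lv :+ lw)))
        refl (X i u) (X j u) (X l u) (X i v) (X j v) (X l v) (X i w) (X j w) (X l w)

  S-polar : ∀ i j l u v w → S i j l * polar i j l u v w ≡ S i j l * polar 0F 1F 2F u v w
  S-polar i j l u v w = +-cancelʳ (s * (m (u + v) + m (u + w) + m (v + w))) _ _ (begin
    s * polar i j l u v w + s * (m (u + v) + m (u + w) + m (v + w))
      ≡⟨ distribˡ s _ _ ⟨
    s * (polar i j l u v w + (m (u + v) + m (u + w) + m (v + w)))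
      ≡⟨ cong (s *_) (polarization i j l u v w) ⟨
    s * (m (u + v + w) + (m u + m v + m w))
      ≡⟨ trans (distrib₄ _ _ _ _) (trans (cong₂ _+_ (e _) (cong₂ _+_ (cong₂ _+_ (e u) (e v)) (e w)))
           (sym (distrib₄ _ _ _ _))) ⟩
    s * (m₀ (u + v + w) + (m₀ u + m₀ v + m₀ w))
      ≡⟨ cong (s *_) (polarization 0F 1F 2F u v w) ⟩
    s * (polar 0F 1F 2F u v w + (m₀ (u + v) + m₀ (u + w) + m₀ (v + w)))
      ≡⟨ trans (distrib₄ _ _ _ _) (cong (s * polar 0F 1F 2F u v w +_)
           (trans (sym (cong₂ _+_ (cong₂ _+_ (e (u + v)) (e (u + w))) (e (v + w)))) (sym (distrib₃ _ _ _)))) ⟩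
    s * polar 0F 1F 2F u v w + s * (m (u + v) + m (u + w) + m (v + w)) ∎)
    where
    s = S i j l
    m = monomial i j l
    m₀ = monomial 0F 1F 2F
    e = S-monomial i j l
    distrib₃ : ∀ b c d → s * (b + c + d) ≡ s * b + s * c + s * d
    distrib₃ = solve 4 (λ s b c d → s :* (b :+ c :+ d) := s :* b :+ s :* c :+ s :* d) refl s
    distrib₄ : ∀ a b c d → s * (a + (b + c + d)) ≡ s * a + (s * b + s * c + s * d)
    distrib₄ = solve 5 (λ s a b c d → s :* (a :+ (b :+ c :+ d)) := s :* a :+ (s :* b :+ s :* c :+ s :* d)) refl s

  𝐞 : Fin 5 → Fin 5 → Carrier
  𝐞 k i = ⟦ i Fin.≟ k ⟧

  -- Rows f, g, h and columns i, j, l. `polar i j l u v w` is the case where the rows consist of the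
  -- values of the X t at w, v and u.
  permanent : (f g h : Fin 5 → Carrier) → Fin 5 → Fin 5 → Fin 5 → Carrier
  permanent f g h i j l =
      f i * (g j * h l + g l * h j)
    + f j * (g i * h l + g l * h i)
    + f l * (g i * h j + g j * h i)

  permanent-swap : ∀ f g h i j l → permanent f g h i j l ≡ permanent g f h i j l
  permanent-swap f g h i j l = solve 9
    (λ a b c d e f g h i →
       a :* (e :* i :+ f :* h) :+ b :* (d :* i :+ f :* g) :+ c :* (d :* h :+ e :* g)
       := d :* (b :* i :+ c :* h) :+ e :* (a :* i :+ c :* g) :+ f :* (a :* h :+ b :* g))
    refl (f i) (f j) (f l) (g i) (g j) (g l) (h i) (h j) (h l)

  permanent-rotate : ∀ f g h i j l → permanent f g h i j l ≡ permanent h f g i j l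
  permanent-rotate f g h i j l = solve 9
    (λ a b c d e f g h i →
       a :* (e :* i :+ f :* h) :+ b :* (d :* i :+ f :* g) :+ c :* (d :* h :+ e :* g)
       := g :* (b :* f :+ c :* e) :+ h :* (a :* f :+ c :* d) :+ i :* (a :* e :+ b :* d))
    refl (f i) (f j) (f l) (g i) (g j) (g l) (h i) (h j) (h l)

  permanent-𝐞 : permanent (𝐞 0F) (𝐞 1F) (𝐞 2F) 0F 1F 2F ≡ 1#
  permanent-𝐞 = solve 0 (con 1 :* (con 1 :* con 1 :+ con 0 :* con 0) :+ con 0 :* (con 0 :* con 1 :+ con 0 :* con 0)
    :+ con 0 :* (con 0 :* con 0 :+ con 1 :* con 0) := con 1) refl

  extract-permanent : ∀ k s g h i j l →
    (∀ x → s * permanent (λ t → X t x) g h i j l ≡ s * permanent (λ t → X t x) g h 0F 1F 2F) →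
    s * permanent (𝐞 k) g h i j l ≡ s * permanent (𝐞 k) g h 0F 1F 2F
  extract-permanent k s g h i j l = extract k s i j l 0F 1F 2F

  -- In `S-polar`, take the coefficient of X₂ in w, then of X₁ in v, then of X₀ in u; the right side
  -- becomes s times the permanent of the identity matrix. `permanent-swap` and `permanent-rotate`
  -- bring the next variable into the first row, where `extract-permanent` acts.
  S-permanent-𝐞 : ∀ i j l → S i j l * permanent (𝐞 0F) (𝐞 1F) (𝐞 2F) i j l ≡ S i j l
  S-permanent-𝐞 i j l = trans
    (extract-permanent 0F s (𝐞 1F) (𝐞 2F) i j l λ u → move (permanent-rotate _ _ _)
      (extract-permanent 1F s (𝐞 2F) (X⟨ u ⟩) i j l λ v → move (permanent-swap _ _ _)
        (extract-permanent 2F s (X⟨ v ⟩) (X⟨ u ⟩) i j l λ w → S-polar i j l u v w)))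
    (trans (cong (s *_) permanent-𝐞) (*-identityʳ s))
    where
    s = S i j l
    X⟨_⟩ : Carrier → Fin 5 → Carrier
    X⟨ u ⟩ t = X t u
    move : ∀ {f g : Fin 5 → Fin 5 → Fin 5 → Carrier} → (∀ i j l → f i j l ≡ g i j l) →
           s * f i j l ≡ s * f 0F 1F 2F → s * g i j l ≡ s * g 0F 1F 2F
    move fg e = trans (cong (s *_) (sym (fg i j l))) (trans e (cong (s *_) (fg 0F 1F 2F)))

  -- The product of the three 𝐞 is the indicator of (i, j, l) = (α, β, γ). At that triple `S` is 1
  -- by pairing the monomial with `ω`; elsewhere both sides vanish.
  S-𝐞 : ∀ α β γ → (∀ x → monomial α β γ x ≡ monomial 0F 1F 2F x) →
        ∀ i j l → S i j l * (𝐞 α i * (𝐞 β j * 𝐞 γ l)) ≡ 𝐞 α i * (𝐞 β j * 𝐞 γ l)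
  S-𝐞 α β γ e i j l with i Fin.≟ α | j Fin.≟ β | l Fin.≟ γ
  ... | yes refl | yes refl | yes refl =
    trans (cong (_* (1# * (1# * 1#)))
      (trans (L-cong e) (∑-pairing (monomial 0F 1F 2F) ω ω-inverse ω-0))) (*-identityˡ _)
  ... | no _ | d | e = solve 2 (λ s t → s :* (con 0 :* t) := con 0 :* t) refl _ _
  ... | yes _ | no _ | e = solve 2 (λ s t → s :* (con 1 :* (con 0 :* t)) := con 1 :* (con 0 :* t)) refl _ _
  ... | yes _ | yes _ | no _ = solve 1 (λ s → s :* (con 1 :* (con 1 :* con 0)) := con 1 :* (con 1 :* con 0)) refl _

  -- Expand the permanent in s = s * permanent into six indicators, one for each permutation of 0,
  -- 1, 2, and drop s from each by `S-𝐞`. This avoids a case distinction over all triples.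
  S≡permanent-𝐞 : ∀ i j l → S i j l ≡ permanent (𝐞 0F) (𝐞 1F) (𝐞 2F) i j l
  S≡permanent-𝐞 i j l = begin
    s                                                  ≡⟨ S-permanent-𝐞 i j l ⟨
    s * permanent (𝐞 0F) (𝐞 1F) (𝐞 2F) i j l           ≡⟨ expand s _ _ _ _ _ _ _ _ _ ⟩
    s * (𝐞 0F i * (𝐞 1F j * 𝐞 2F l)) + s * (𝐞 0F i * (𝐞 2F j * 𝐞 1F l))
      + (s * (𝐞 1F i * (𝐞 0F j * 𝐞 2F l)) + s * (𝐞 2F i * (𝐞 0F j * 𝐞 1F l)))
      + (s * (𝐞 1F i * (𝐞 2F j * 𝐞 0F l)) + s * (𝐞 2F i * (𝐞 1F j * 𝐞 0F l)))
      ≡⟨ cong₂ _+_ (cong₂ _+_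
           (cong₂ _+_ (S-𝐞 0F 1F 2F (λ x → refl) i j l) (S-𝐞 0F 2F 1F (λ x → acb (X 0F x) (X 1F x) (X 2F x)) i j l))
           (cong₂ _+_ (S-𝐞 1F 0F 2F (λ x → bac (X 0F x) (X 1F x) (X 2F x)) i j l)
                      (S-𝐞 2F 0F 1F (λ x → cab (X 0F x) (X 1F x) (X 2F x)) i j l)))
           (cong₂ _+_ (S-𝐞 1F 2F 0F (λ x → bca (X 0F x) (X 1F x) (X 2F x)) i j l)
                      (S-𝐞 2F 1F 0F (λ x → cba (X 0F x) (X 1F x) (X 2F x)) i j l)) ⟩
    𝐞 0F i * (𝐞 1F j * 𝐞 2F l) + 𝐞 0F i * (𝐞 2F j * 𝐞 1F l)
      + (𝐞 1F i * (𝐞 0F j * 𝐞 2F l) + 𝐞 2F i * (𝐞 0F j * 𝐞 1F l))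
      + (𝐞 1F i * (𝐞 2F j * 𝐞 0F l) + 𝐞 2F i * (𝐞 1F j * 𝐞 0F l))
      ≡⟨ solve 9 (λ a b c d e f g h i →
           a :* (e :* i) :+ a :* (h :* f) :+ (d :* (b :* i) :+ g :* (b :* f)) :+ (d :* (h :* c) :+ g :* (e :* c))
           := a :* (e :* i :+ f :* h) :+ b :* (d :* i :+ f :* g) :+ c :* (d :* h :+ e :* g)) refl
           (𝐞 0F i) (𝐞 0F j) (𝐞 0F l) (𝐞 1F i) (𝐞 1F j) (𝐞 1F l) (𝐞 2F i) (𝐞 2F j) (𝐞 2F l) ⟩
    permanent (𝐞 0F) (𝐞 1F) (𝐞 2F) i j l               ∎
    where
    s = S i j l
    expand : ∀ s a b c d e f g h i →
      s * (a * (e * i + f * h) + b * (d * i + f * g) + c * (d * h + e * g))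
      ≡ s * (a * (e * i)) + s * (a * (h * f)) + (s * (d * (b * i)) + s * (g * (b * f)))
        + (s * (d * (h * c)) + s * (g * (e * c)))
    expand = solve 10 (λ s a b c d e f g h i →
      s :* (a :* (e :* i :+ f :* h) :+ b :* (d :* i :+ f :* g) :+ c :* (d :* h :+ e :* g))
      := s :* (a :* (e :* i)) :+ s :* (a :* (h :* f)) :+ (s :* (d :* (b :* i)) :+ s :* (g :* (b :* f)))
        :+ (s :* (d :* (h :* c)) :+ s :* (g :* (e :* c)))) refl
    acb : ∀ a b c → a * c * b ≡ a * b * c
    acb = solve 3 (λ a b c → a :* c :* b := a :* b :* c) refl
    bac : ∀ a b c → b * a * c ≡ a * b * c
    bac = solve 3 (λ a b c → b :* a :* c := a :* b :* c) refl
    cab : ∀ a b c → c * a * b ≡ a * b * c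
    cab = solve 3 (λ a b c → c :* a :* b := a :* b :* c) refl
    bca : ∀ a b c → b * c * a ≡ a * b * c
    bca = solve 3 (λ a b c → b :* c :* a := a :* b :* c) refl
    cba : ∀ a b c → c * b * a ≡ a * b * c
    cba = solve 3 (λ a b c → c :* b :* a := a :* b :* c) refl

  ev : (Fin 5 → Carrier) → Carrier → Carrier
  ev b x = sum (λ i → b i * X i x)

  collapse : ∀ (d : Fin 5 → Carrier) A B C →
    sum (λ i → d i * (𝐞 0F i * A + 𝐞 1F i * B + 𝐞 2F i * C)) ≡ d 0F * A + d 1F * B + d 2F * C
  collapse d A B C = solve 8 (λ d₀ d₁ d₂ d₃ d₄ A B C →
         d₀ :* (con 1 :* A :+ con 0 :* B :+ con 0 :* C)
      :+ (d₁ :* (con 0 :* A :+ con 1 :* B :+ con 0 :* C)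
      :+ (d₂ :* (con 0 :* A :+ con 0 :* B :+ con 1 :* C)
      :+ (d₃ :* (con 0 :* A :+ con 0 :* B :+ con 0 :* C)
      :+ (d₄ :* (con 0 :* A :+ con 0 :* B :+ con 0 :* C)
      :+ con 0))))
      := d₀ :* A :+ d₁ :* B :+ d₂ :* C)
    refl (d 0F) (d 1F) (d 2F) (d 3F) (d 4F) A B C

  -- By trilinearity the left side is the sum of all bᵢ cⱼ dₗ S i j l, in which exactly the six
  -- permutations of 0, 1, 2 survive, each with weight 1.
  L-ev : ∀ b c d → L (λ x → ev b x * ev c x * ev d x) ≡ permanent b c d 0F 1F 2F
  L-ev b c d = begin
    L (λ x → ev b x * ev c x * ev d x)
      ≡⟨ L-cong (λ x → *-assoc (ev b x) (ev c x) (ev d x)) ⟩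
    L (λ x → ev b x * (ev c x * ev d x))
      ≡⟨ L-ev* b (λ x → ev c x * ev d x) ⟩
    sum (λ i → b i * L (λ x → X i x * (ev c x * ev d x)))
      ≡⟨ sum-cong-≗ (λ i → cong (b i *_) (inner₁ i)) ⟩
    sum (λ i → b i * (𝐞 0F i * (c 1F * d 2F + c 2F * d 1F) + 𝐞 1F i * (c 0F * d 2F + c 2F * d 0F)
                      + 𝐞 2F i * (c 0F * d 1F + c 1F * d 0F)))
      ≡⟨ collapse b _ _ _ ⟩
    permanent b c d 0F 1F 2F ∎
    where
    L-ev* : ∀ b f → L (λ x → ev b x * f x) ≡ sum (λ i → b i * L (λ x → X i x * f x))
    L-ev* b f = trans (L-cong λ x → trans (*-distribʳ-sum (f x) (λ i → b i * X i x))
                        (sum-cong-≗ λ i → *-assoc (b i) (X i x) (f x)))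
                      (L-sum b (λ i x → X i x * f x))
    inner₂ : ∀ i j → L (λ x → X i x * (X j x * ev d x)) ≡
      d 0F * (𝐞 1F i * 𝐞 2F j + 𝐞 2F i * 𝐞 1F j) + d 1F * (𝐞 0F i * 𝐞 2F j + 𝐞 2F i * 𝐞 0F j)
        + d 2F * (𝐞 0F i * 𝐞 1F j + 𝐞 1F i * 𝐞 0F j)
    inner₂ i j = begin
      L (λ x → X i x * (X j x * ev d x))
        ≡⟨ L-cong (λ x → solve 3 (λ a b c → a :* (b :* c) := c :* (a :* b)) refl (X i x) (X j x) (ev d x)) ⟩
      L (λ x → ev d x * (X i x * X j x))
        ≡⟨ L-ev* d (λ x → X i x * X j x) ⟩
      sum (λ l → d l * L (λ x → X l x * (X i x * X j x)))
        ≡⟨ sum-cong-≗ (λ l → cong (d l *_)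
             (trans (L-cong λ x → *-comm (X l x) (X i x * X j x)) (S≡permanent-𝐞 i j l))) ⟩
      sum (λ l → d l * permanent (𝐞 0F) (𝐞 1F) (𝐞 2F) i j l)
        ≡⟨ sum-cong-≗ (λ l → cong (d l *_) (solve 9 (λ a b c d e f g h i →
             a :* (e :* i :+ f :* h) :+ b :* (d :* i :+ f :* g) :+ c :* (d :* h :+ e :* g)
             := c :* (d :* h :+ g :* e) :+ f :* (a :* h :+ g :* b) :+ i :* (a :* e :+ d :* b)) refl
             (𝐞 0F i) (𝐞 0F j) (𝐞 0F l) (𝐞 1F i) (𝐞 1F j) (𝐞 1F l) (𝐞 2F i) (𝐞 2F j) (𝐞 2F l))) ⟩
      sum (λ l → d l * (𝐞 0F l * (𝐞 1F i * 𝐞 2F j + 𝐞 2F i * 𝐞 1F j) + 𝐞 1F l * (𝐞 0F i * 𝐞 2F j + 𝐞 2F i * 𝐞 0F j)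
                        + 𝐞 2F l * (𝐞 0F i * 𝐞 1F j + 𝐞 1F i * 𝐞 0F j)))
        ≡⟨ collapse d _ _ _ ⟩
      _ ∎
    inner₁ : ∀ i → L (λ x → X i x * (ev c x * ev d x)) ≡
      𝐞 0F i * (c 1F * d 2F + c 2F * d 1F) + 𝐞 1F i * (c 0F * d 2F + c 2F * d 0F)
        + 𝐞 2F i * (c 0F * d 1F + c 1F * d 0F)
    inner₁ i = begin
      L (λ x → X i x * (ev c x * ev d x))
        ≡⟨ L-cong (λ x → solve 3 (λ a b c → a :* (b :* c) := b :* (a :* c)) refl (X i x) (ev c x) (ev d x)) ⟩
      L (λ x → ev c x * (X i x * ev d x))
        ≡⟨ L-ev* c (λ x → X i x * ev d x) ⟩
      sum (λ j → c j * L (λ x → X j x * (X i x * ev d x)))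
        ≡⟨ sum-cong-≗ (λ j → cong (c j *_) (trans (inner₂ j i)
             (solve 9 (λ d₀ d₁ d₂ i₀ i₁ i₂ j₀ j₁ j₂ →
                d₀ :* (j₁ :* i₂ :+ j₂ :* i₁) :+ d₁ :* (j₀ :* i₂ :+ j₂ :* i₀) :+ d₂ :* (j₀ :* i₁ :+ j₁ :* i₀)
                := j₀ :* (i₁ :* d₂ :+ i₂ :* d₁) :+ j₁ :* (i₀ :* d₂ :+ i₂ :* d₀) :+ j₂ :* (i₀ :* d₁ :+ i₁ :* d₀)) refl
                (d 0F) (d 1F) (d 2F) (𝐞 0F i) (𝐞 1F i) (𝐞 2F i) (𝐞 0F j) (𝐞 1F j) (𝐞 2F j)))) ⟩
      sum (λ j → c j * (𝐞 0F j * (𝐞 1F i * d 2F + 𝐞 2F i * d 1F) + 𝐞 1F j * (𝐞 0F i * d 2F + 𝐞 2F i * d 0F)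
                        + 𝐞 2F j * (𝐞 0F i * d 1F + 𝐞 1F i * d 0F)))
        ≡⟨ collapse c _ _ _ ⟩
      c 0F * (𝐞 1F i * d 2F + 𝐞 2F i * d 1F) + c 1F * (𝐞 0F i * d 2F + 𝐞 2F i * d 0F)
        + c 2F * (𝐞 0F i * d 1F + 𝐞 1F i * d 0F)
        ≡⟨ solve 9 (λ d₀ d₁ d₂ i₀ i₁ i₂ c₀ c₁ c₂ →
                c₀ :* (i₁ :* d₂ :+ i₂ :* d₁) :+ c₁ :* (i₀ :* d₂ :+ i₂ :* d₀) :+ c₂ :* (i₀ :* d₁ :+ i₁ :* d₀)
                := i₀ :* (c₁ :* d₂ :+ c₂ :* d₁) :+ i₁ :* (c₀ :* d₂ :+ c₂ :* d₀) :+ i₂ :* (c₀ :* d₁ :+ c₁ :* d₀)) refl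
                (d 0F) (d 1F) (d 2F) (𝐞 0F i) (𝐞 1F i) (𝐞 2F i) (c 0F) (c 1F) (c 2F) ⟩
      _ ∎

  -- Slopes and sums over them

  ev-+ : ∀ b → Additive (ev b)
  ev-+ b x y = trans (sum-cong-≗ λ i → trans (cong (b i *_) (X-+ i x y)) (distribˡ (b i) _ _))
                     (∑-distrib-+ (λ i → b i * X i x) (λ i → b i * X i y))

  -- Says that ⟨(1,m)⟩ lies in L_h. Since L_h misses ⟨(0,1)⟩, the slopes determine the whole point
  -- set.
  HasSlope : (Carrier → Carrier) → Carrier → Set
  HasSlope h m = ∃ λ x → ¬ x ≡ 0# × h x ≡ m * x

  SameSlopes : (h g : Carrier → Carrier) → Set
  SameSlopes h g = ∀ m → HasSlope h m ⇔ HasSlope g m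

  hasSlope? : ∀ h m → Dec (HasSlope h m)
  hasSlope? h m = map′
    (λ (i , p) → from i , p)
    (λ (x , p) → to x , subst (λ x → ¬ x ≡ 0# × h x ≡ m * x) (sym (strictlyInverseʳ x)) p)
    (Fin.any? λ i → ¬? (from i ≟ 0#) ×-dec (h (from i) ≟ m * from i))

  -- For additive h this is the order of the kernel of x ↦ h x - m x, with x = 0 included, read in
  -- F. It is therefore 1 for a trivial kernel and 0 otherwise.
  slopeCount : (Carrier → Carrier) → Carrier → Carrier
  slopeCount h m = ∑ λ x → ⟦ h x ≟ m * x ⟧

  slopeCount-yes : ∀ {h} → Additive h → ∀ {m} → HasSlope h m → slopeCount h m ≡ 0#
  slopeCount-yes {h} h-+ {m} (u , u≢0 , hu≡mu) = count-invariant (λ x → h x ≟ m * x) u u≢0 λ x → mk⇔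
    (λ e → trans (h-+ x u) (trans (cong₂ _+_ e hu≡mu) (sym (distribˡ m x u))))
    (λ e → +-cancelʳ (m * u) _ _ (begin
      h x + m * u       ≡⟨ cong (h x +_) hu≡mu ⟨
      h x + h u         ≡⟨ h-+ x u ⟨
      h (x + u)         ≡⟨ e ⟩
      m * (x + u)       ≡⟨ distribˡ m x u ⟩
      m * x + m * u     ∎))

  slopeCount-no : ∀ {h} → Additive h → ∀ {m} → ¬ HasSlope h m → slopeCount h m ≡ 1#
  slopeCount-no {h} h-+ {m} ¬slope = trans (∑-cong λ x → ⟦⟧-cong (h x ≟ m * x) (x ≟ 0#) (mk⇔
    (λ e → decidable-stable (x ≟ 0#) λ x≢0 → ¬slope (x , x≢0 , e))
    (λ { refl → trans (additive-0 h-+) (sym (zeroʳ m)) }))) (∑-⟦≟⟧ 0#)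

  slopeCount-cong : ∀ {h g} → Additive h → Additive g → SameSlopes h g → ∀ m → slopeCount h m ≡ slopeCount g m
  slopeCount-cong {h} h-+ g-+ same m with hasSlope? h m
  ... | yes s = trans (slopeCount-yes h-+ s) (sym (slopeCount-yes g-+ (Equivalence.to (same m) s)))
  ... | no ¬s = trans (slopeCount-no h-+ ¬s) (sym (slopeCount-no g-+ (¬s ∘ Equivalence.from (same m))))

  slope-determined : ∀ (h : Carrier → Carrier) {x} → ¬ x ≡ 0# → ∀ m → (h x ≡ m * x) ⇔ (m ≡ h x * x ⁻¹)
  slope-determined h {x} x≢0 m = mk⇔
    (λ e → sym (begin
      h x * x ⁻¹       ≡⟨ cong (_* x ⁻¹) e ⟩
      m * x * x ⁻¹     ≡⟨ *-assoc m x _ ⟩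
      m * (x * x ⁻¹)   ≡⟨ cong (m *_) (x*x⁻¹≡1 x≢0) ⟩
      m * 1#           ≡⟨ *-identityʳ m ⟩
      m                ∎))
    (λ { refl → sym (begin
      h x * x ⁻¹ * x     ≡⟨ *-assoc (h x) _ x ⟩
      h x * (x ⁻¹ * x)   ≡⟨ cong (h x *_) (trans (*-comm _ x) (x*x⁻¹≡1 x≢0)) ⟩
      h x * 1#           ≡⟨ *-identityʳ _ ⟩
      h x                ∎) })

  -- Double counting of the pairs (m, x) with h x = m x. Each x ≠ 0 has exactly one m, namely h x /
  -- x, while x = 0 admits every m and contributes ∑ Ψ. Since 0⁻¹ = 0 and Ψ(0) = 0, the last sum has
  -- no term at x = 0.
  ∑-slopes : ∀ {h} → Additive h → ∀ (Ψ : Carrier → Carrier) → Ψ 0# ≡ 0# →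
             ∑ (λ m → Ψ m * slopeCount h m) ≡ ∑ Ψ + ∑ (λ x → Ψ (h x * x ⁻¹))
  ∑-slopes {h} h-+ Ψ Ψ0≡0 = begin
    ∑ (λ m → Ψ m * slopeCount h m)
      ≡⟨ ∑-cong (λ m → sym (∑-* (Ψ m) _)) ⟩
    ∑ (λ m → ∑ (λ x → Ψ m * ⟦ h x ≟ m * x ⟧))
      ≡⟨ ∑-swap _ ⟩
    ∑ (λ x → ∑ (λ m → Ψ m * ⟦ h x ≟ m * x ⟧))
      ≡⟨ ∑-cong (λ x → at x (x ≟ 0#)) ⟩
    ∑ (λ x → ⟦ x ≟ 0# ⟧ * ∑ Ψ + Ψ (h x * x ⁻¹))
      ≡⟨ ∑-+ _ _ ⟩
    ∑ (λ x → ⟦ x ≟ 0# ⟧ * ∑ Ψ) + ∑ (λ x → Ψ (h x * x ⁻¹))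
      ≡⟨ cong (_+ ∑ (λ x → Ψ (h x * x ⁻¹))) (∑-pick 0# (λ _ → ∑ Ψ)) ⟩
    ∑ Ψ + ∑ (λ x → Ψ (h x * x ⁻¹)) ∎
    where
    at : ∀ x (d : Dec (x ≡ 0#)) → ∑ (λ m → Ψ m * ⟦ h x ≟ m * x ⟧) ≡ ⟦ d ⟧ * ∑ Ψ + Ψ (h x * x ⁻¹)
    at x (yes refl) = begin
      ∑ (λ m → Ψ m * ⟦ h 0# ≟ m * 0# ⟧)
        ≡⟨ ∑-cong (λ m → cong (Ψ m *_) (if-yes (h 0# ≟ m * 0#) (trans (additive-0 h-+) (sym (zeroʳ m))))) ⟩
      ∑ (λ m → Ψ m * 1#)
        ≡⟨ ∑-cong (λ m → *-identityʳ (Ψ m)) ⟩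
      ∑ Ψ
        ≡⟨ trans (cong (_+ 0#) (*-identityˡ (∑ Ψ))) (+-identityʳ (∑ Ψ)) ⟨
      1# * ∑ Ψ + 0#
        ≡⟨ cong (1# * ∑ Ψ +_) (trans (cong Ψ (trans (cong (h 0# *_) 0⁻¹≡0) (zeroʳ (h 0#)))) Ψ0≡0) ⟨
      1# * ∑ Ψ + Ψ (h 0# * 0# ⁻¹) ∎
    at x (no x≢0) = begin
      ∑ (λ m → Ψ m * ⟦ h x ≟ m * x ⟧)
        ≡⟨ ∑-cong (λ m → trans (*-comm (Ψ m) _)
             (cong (_* Ψ m) (⟦⟧-cong (h x ≟ m * x) (m ≟ h x * x ⁻¹) (slope-determined h x≢0 m)))) ⟩
      ∑ (λ m → ⟦ m ≟ h x * x ⁻¹ ⟧ * Ψ m)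
        ≡⟨ ∑-pick (h x * x ⁻¹) Ψ ⟩
      Ψ (h x * x ⁻¹)
        ≡⟨ trans (cong (_+ Ψ (h x * x ⁻¹)) (zeroˡ (∑ Ψ))) (+-identityˡ _) ⟨
      0# * ∑ Ψ + Ψ (h x * x ⁻¹) ∎

  ∑-slopes-cong : ∀ {h g} → Additive h → Additive g → SameSlopes h g → ∀ (Ψ : Carrier → Carrier) → Ψ 0# ≡ 0# →
                  ∑ (λ x → Ψ (h x * x ⁻¹)) ≡ ∑ (λ x → Ψ (g x * x ⁻¹))
  ∑-slopes-cong {h} {g} h-+ g-+ same Ψ Ψ0≡0 = +-cancelˡ (∑ Ψ) _ _ (begin
    ∑ Ψ + ∑ (λ x → Ψ (h x * x ⁻¹))     ≡⟨ ∑-slopes h-+ Ψ Ψ0≡0 ⟨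
    ∑ (λ m → Ψ m * slopeCount h m)     ≡⟨ ∑-cong (λ m → cong (Ψ m *_) (slopeCount-cong h-+ g-+ same m)) ⟩
    ∑ (λ m → Ψ m * slopeCount g m)     ≡⟨ ∑-slopes g-+ Ψ Ψ0≡0 ⟩
    ∑ Ψ + ∑ (λ x → Ψ (g x * x ⁻¹))     ∎)

  -- The coefficients of φ ∘ ev b; the shift is cyclic because φ⁵ is the identity.
  twist : (Fin 5 → Carrier) → Fin 5 → Carrier
  twist b zero = φ (b 4F)
  twist b (suc i) = φ (b (inject₁ i))

  ev-twist : ∀ b x → ev (twist b) x ≡ φ (ev b x)
  ev-twist b x = sym (begin
    φ (ev b x)
      ≡⟨ trans (φ-+ _ _) (cong₂ _+_ (φ-* _ _) (trans (φ-+ _ _) (cong₂ _+_ (φ-* _ _) (trans (φ-+ _ _)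
           (cong₂ _+_ (φ-* _ _) (trans (φ-+ _ _) (cong₂ _+_ (φ-* _ _) (trans (φ-+ _ _) (cong₂ _+_
           (trans (φ-* _ _) (cong (φ (b 4F) *_) (φ-order x))) (X-0 1F)))))))))) ⟩
    φ (b 0F) * X 1F x + (φ (b 1F) * X 2F x + (φ (b 2F) * X 3F x + (φ (b 3F) * X 4F x + (φ (b 4F) * x + 0#))))
      ≡⟨ solve 5 (λ p q r s t → p :+ (q :+ (r :+ (s :+ (t :+ con 0)))) := t :+ (p :+ (q :+ (r :+ (s :+ con 0))))) refl
           _ _ _ _ _ ⟩
    ev (twist b) x ∎)

  -- `ω` supplies one reciprocal for each of the factors ev b, φ ∘ ev c and φ² ∘ ev d, turning each
  -- into a twisted slope. Choosing P and Q as the identity or the constant 1 keeps or drops φ(m)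
  -- and φ²(m), so one statement serves all four Ψ.
  permanent-slopes : ∀ b c d (P Q : Carrier → Carrier) →
    (∀ {x} → ¬ x ≡ 0# → ev c x * x ⁻¹ ≡ P (ev b x * x ⁻¹)) →
    (∀ {x} → ¬ x ≡ 0# → ev d x * x ⁻¹ ≡ Q (ev b x * x ⁻¹)) →
    permanent b (twist c) (twist (twist d)) 0F 1F 2F
      ≡ - ∑ (λ x → (λ m → m * φ (P m) * φ (φ (Q m))) (ev b x * x ⁻¹))
  permanent-slopes b c d P Q cP dQ = trans (sym (L-ev b (twist c) (twist (twist d)))) (cong -_ (∑-cong at))
    where
    at : ∀ x → ev b x * ev (twist c) x * ev (twist (twist d)) x * ω x
             ≡ ev b x * x ⁻¹ * φ (P (ev b x * x ⁻¹)) * φ (φ (Q (ev b x * x ⁻¹)))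
    at x with x ≟ 0#
    ... | yes refl = trans (trans (cong (ev b 0# * ev (twist c) 0# * ev (twist (twist d)) 0# *_) ω-0) (zeroʳ _))
      (sym (trans (cong (λ t → t * φ (P (ev b 0# * 0# ⁻¹)) * φ (φ (Q (ev b 0# * 0# ⁻¹))))
        (trans (cong (_* 0# ⁻¹) (additive-0 (ev-+ b))) (zeroˡ _)))
        (trans (cong (_* φ (φ (Q (ev b 0# * 0# ⁻¹)))) (zeroˡ _)) (zeroˡ _))))
    ... | no x≢0 = begin
      ev b x * ev (twist c) x * ev (twist (twist d)) x * ω x
        ≡⟨ cong₂ (λ s t → ev b x * s * t * ω x) (ev-twist c x)
             (trans (ev-twist (twist d) x) (cong φ (ev-twist d x))) ⟩
      ev b x * φ (ev c x) * φ (φ (ev d x)) * ω x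
        ≡⟨ solve 6 (λ a b c d e f → a :* b :* c :* (d :* e :* f) := a :* d :* (b :* e) :* (c :* f)) refl
             (ev b x) (φ (ev c x)) (φ (φ (ev d x))) (x ⁻¹) (φ (x ⁻¹)) (φ (φ (x ⁻¹))) ⟩
      ev b x * x ⁻¹ * (φ (ev c x) * φ (x ⁻¹)) * (φ (φ (ev d x)) * φ (φ (x ⁻¹)))
        ≡⟨ cong₂ (λ s t → ev b x * x ⁻¹ * s * t) (φ-* _ _) (trans (cong φ (φ-* _ _)) (φ-* _ _)) ⟨
      ev b x * x ⁻¹ * φ (ev c x * x ⁻¹) * φ (φ (ev d x * x ⁻¹))
        ≡⟨ cong₂ (λ s t → ev b x * x ⁻¹ * φ s * φ (φ t)) (cP x≢0) (dQ x≢0) ⟩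
      ev b x * x ⁻¹ * φ (P (ev b x * x ⁻¹)) * φ (φ (Q (ev b x * x ⁻¹))) ∎

  permanent-cong-slopes : ∀ b b' → SameSlopes (ev b) (ev b') → ∀ c c' d d' (P Q : Carrier → Carrier) →
    (∀ {x} → ¬ x ≡ 0# → ev c x * x ⁻¹ ≡ P (ev b x * x ⁻¹)) →
    (∀ {x} → ¬ x ≡ 0# → ev d x * x ⁻¹ ≡ Q (ev b x * x ⁻¹)) →
    (∀ {x} → ¬ x ≡ 0# → ev c' x * x ⁻¹ ≡ P (ev b' x * x ⁻¹)) →
    (∀ {x} → ¬ x ≡ 0# → ev d' x * x ⁻¹ ≡ Q (ev b' x * x ⁻¹)) →
    permanent b (twist c) (twist (twist d)) 0F 1F 2F ≡ permanent b' (twist c') (twist (twist d')) 0F 1F 2F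
  permanent-cong-slopes b b' same c c' d d' P Q cP dQ c'P d'Q = begin
    permanent b (twist c) (twist (twist d)) 0F 1F 2F
      ≡⟨ permanent-slopes b c d P Q cP dQ ⟩
    - ∑ (λ x → Ψ (ev b x * x ⁻¹))
      ≡⟨ cong -_ (∑-slopes-cong (ev-+ b) (ev-+ b') same Ψ (trans (cong (_* φ (φ (Q 0#))) (zeroˡ _)) (zeroˡ _))) ⟩
    - ∑ (λ x → Ψ (ev b' x * x ⁻¹))
      ≡⟨ permanent-slopes b' c' d' P Q c'P d'Q ⟨
    permanent b' (twist c') (twist (twist d')) 0F 1F 2F ∎
    where
    Ψ : Carrier → Carrier
    Ψ m = m * φ (P m) * φ (φ (Q m))

  -- Coefficients of the identity map, whose slope is always 1; it stands in for a dropped factor of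
  -- Ψ.
  unit : Fin 5 → Carrier
  unit = 𝐞 0F

  ev-unit : ∀ {x} → ¬ x ≡ 0# → ev unit x * x ⁻¹ ≡ 1#
  ev-unit {x} x≢0 = trans (cong (_* x ⁻¹) (solve 5 (λ a b c d e → con 1 :* a :+ (con 0 :* b :+ (con 0 :* c
    :+ (con 0 :* d :+ (con 0 :* e :+ con 0)))) := a) refl (X 0F x) (X 1F x) (X 2F x) (X 3F x) (X 4F x))) (x*x⁻¹≡1 x≢0)

  -- The four moments of a linearized polynomial

  permanent-values : ∀ f g h {f₀ f₁ f₂ g₀ g₁ g₂ h₀ h₁ h₂} →
    f 0F ≡ f₀ → f 1F ≡ f₁ → f 2F ≡ f₂ → g 0F ≡ g₀ → g 1F ≡ g₁ → g 2F ≡ g₂ →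
    h 0F ≡ h₀ → h 1F ≡ h₁ → h 2F ≡ h₂ →
    permanent f g h 0F 1F 2F ≡ f₀ * (g₁ * h₂ + g₂ * h₁) + f₁ * (g₀ * h₂ + g₂ * h₀) + f₂ * (g₀ * h₁ + g₁ * h₀)
  permanent-values f g h refl refl refl refl refl refl refl refl refl = refl

  φ-0 : φ 0# ≡ 0#
  φ-0 = X-0 1F

  φφ-0 : φ (φ 0#) ≡ 0#
  φφ-0 = X-0 2F

  moment₁ : ∀ b → permanent b (twist unit) (twist (twist unit)) 0F 1F 2F ≡ b 0F
  moment₁ b = trans
    (permanent-values b (twist unit) (twist (twist unit)) refl refl refl φ-0 φ-1 φ-0 φφ-0 φφ-0 (X-1 2F))
    (solve 3 (λ x y z → x :* (con 1 :* con 1 :+ con 0 :* con 0) :+ y :* (con 0 :* con 1 :+ con 0 :* con 0)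
      :+ z :* (con 0 :* con 0 :+ con 1 :* con 0) := x) refl (b 0F) (b 1F) (b 2F))

  module _ (b : Fin 5 → Carrier) (b₀≡0 : b 0F ≡ 0#) where

    moment₂ : permanent b (twist b) (twist (twist unit)) 0F 1F 2F ≡ b 1F * φ (b 4F)
    moment₂ = trans
      (permanent-values b (twist b) (twist (twist unit))
        b₀≡0 refl refl refl (trans (cong φ b₀≡0) φ-0) refl φφ-0 φφ-0 (X-1 2F))
      (solve 4 (λ y z p q → con 0 :* (con 0 :* con 1 :+ p :* con 0) :+ y :* (q :* con 1 :+ p :* con 0)
        :+ z :* (q :* con 0 :+ con 0 :* con 0) := y :* q) refl (b 1F) (b 2F) (φ (b 1F)) (φ (b 4F)))

    moment₃ : permanent b (twist unit) (twist (twist b)) 0F 1F 2F ≡ b 2F * φ (φ (b 3F))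
    moment₃ = trans
      (permanent-values b (twist unit) (twist (twist b))
        b₀≡0 refl refl φ-0 φ-1 φ-0 refl refl (trans (cong (φ ∘ φ) b₀≡0) φφ-0))
      (solve 4 (λ y z p q → con 0 :* (con 1 :* con 0 :+ con 0 :* q) :+ y :* (con 0 :* con 0 :+ con 0 :* p)
        :+ z :* (con 0 :* q :+ con 1 :* p) := z :* p) refl (b 1F) (b 2F) (φ (φ (b 3F))) (φ (φ (b 4F))))

    -- The rows are (b₀, b₁, b₂), (φ b₄, φ b₀, φ b₁) and (φ² b₃, φ² b₄, φ² b₀). With b₀ = 0 the
    -- diagonal vanishes, and only the two derangements of the columns remain.
    moment₄ : permanent b (twist b) (twist (twist b)) 0F 1F 2F
            ≡ b 1F * φ (b 1F) * φ (φ (b 3F)) + b 2F * φ (b 4F) * φ (φ (b 4F))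
    moment₄ = trans
      (permanent-values b (twist b) (twist (twist b)) b₀≡0 refl refl refl (trans (cong φ b₀≡0) φ-0) refl
        refl refl (trans (cong (φ ∘ φ) b₀≡0) φφ-0))
      (solve 6 (λ y z p q r s → con 0 :* (con 0 :* con 0 :+ p :* s) :+ y :* (q :* con 0 :+ p :* r)
        :+ z :* (q :* s :+ con 0 :* r) := y :* p :* r :+ z :* q :* s) refl
        (b 1F) (b 2F) (φ (b 1F)) (φ (b 4F)) (φ (φ (b 3F))) (φ (φ (b 4F))))

  -- Linearized polynomials with the slopes of a binomial

  binomial : Carrier → Fin 5 → Carrier
  binomial μ 1F = μ
  binomial μ 4F = 1#
  binomial μ _ = 0#

  module SlopesOfBinomial {b μ} (μ≢0 : ¬ μ ≡ 0#) (same : SameSlopes (ev b) (ev (binomial μ))) where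

    b₀≡0 : b 0F ≡ 0#
    b₀≡0 = trans (sym (moment₁ b)) (trans
      (permanent-cong-slopes b (binomial μ) same unit unit unit unit
        (λ _ → 1#) (λ _ → 1#) ev-unit ev-unit ev-unit ev-unit)
      (moment₁ (binomial μ)))

    b₁φb₄≡μ : b 1F * φ (b 4F) ≡ μ
    b₁φb₄≡μ = begin
      b 1F * φ (b 4F)
        ≡⟨ moment₂ b b₀≡0 ⟨
      permanent b (twist b) (twist (twist unit)) 0F 1F 2F
        ≡⟨ permanent-cong-slopes b (binomial μ) same b (binomial μ) unit unit
             (λ m → m) (λ _ → 1#) (λ _ → refl) ev-unit (λ _ → refl) ev-unit ⟩
      permanent (binomial μ) (twist (binomial μ)) (twist (twist unit)) 0F 1F 2F
        ≡⟨ moment₂ (binomial μ) refl ⟩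
      μ * φ 1#
        ≡⟨ trans (cong (μ *_) φ-1) (*-identityʳ μ) ⟩
      μ ∎

    b₂φφb₃≡0 : b 2F * φ (φ (b 3F)) ≡ 0#
    b₂φφb₃≡0 = begin
      b 2F * φ (φ (b 3F))
        ≡⟨ moment₃ b b₀≡0 ⟨
      permanent b (twist unit) (twist (twist b)) 0F 1F 2F
        ≡⟨ permanent-cong-slopes b (binomial μ) same unit unit b (binomial μ)
             (λ _ → 1#) (λ m → m) ev-unit (λ _ → refl) ev-unit (λ _ → refl) ⟩
      permanent (binomial μ) (twist unit) (twist (twist (binomial μ))) 0F 1F 2F
        ≡⟨ moment₃ (binomial μ) refl ⟩
      0# * φ (φ 0#)
        ≡⟨ zeroˡ _ ⟩
      0# ∎

    cubic≡0 : b 1F * φ (b 1F) * φ (φ (b 3F)) + b 2F * φ (b 4F) * φ (φ (b 4F)) ≡ 0#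
    cubic≡0 = begin
      b 1F * φ (b 1F) * φ (φ (b 3F)) + b 2F * φ (b 4F) * φ (φ (b 4F))
        ≡⟨ moment₄ b b₀≡0 ⟨
      permanent b (twist b) (twist (twist b)) 0F 1F 2F
        ≡⟨ permanent-cong-slopes b (binomial μ) same b (binomial μ) b (binomial μ)
             (λ m → m) (λ m → m) (λ _ → refl) (λ _ → refl) (λ _ → refl) (λ _ → refl) ⟩
      permanent (binomial μ) (twist (binomial μ)) (twist (twist (binomial μ))) 0F 1F 2F
        ≡⟨ moment₄ (binomial μ) refl ⟩
      μ * φ μ * φ (φ 0#) + 0# * φ 1# * φ (φ 1#)
        ≡⟨ cong (λ t → μ * φ μ * t + 0# * φ 1# * φ (φ 1#)) φφ-0 ⟩
      μ * φ μ * 0# + 0# * φ 1# * φ (φ 1#)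
        ≡⟨ solve 3 (λ x y z → x :* con 0 :+ con 0 :* y :* z := con 0) refl (μ * φ μ) (φ 1#) (φ (φ 1#)) ⟩
      0# ∎

    b₁φb₄≢0 : ¬ b 1F * φ (b 4F) ≡ 0#
    b₁φb₄≢0 = μ≢0 ∘ trans (sym b₁φb₄≡μ)

    b₁≢0 : ¬ b 1F ≡ 0#
    b₁≢0 = xy≢0⇒x≢0 b₁φb₄≢0

    φb₄≢0 : ¬ φ (b 4F) ≡ 0#
    φb₄≢0 = xy≢0⇒y≢0 b₁φb₄≢0

    -- The third moment makes one of b₂, b₃ vanish. The fourth then reduces to a single product
    -- whose other factors, built from b₁ or b₄, are nonzero.
    b₂≡0×b₃≡0 : b 2F ≡ 0# × b 3F ≡ 0#
    b₂≡0×b₃≡0 with b 2F ≟ 0# | b 3F ≟ 0#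
    ... | yes b₂≡0 | yes b₃≡0 = b₂≡0 , b₃≡0
    ... | no b₂≢0 | no b₃≢0 = contradiction b₂φφb₃≡0 (*-≢0 b₂≢0 (X≢0 2F b₃≢0))
    ... | yes b₂≡0 | no b₃≢0 = contradiction
      (begin
        b 1F * φ (b 1F) * φ (φ (b 3F))
          ≡⟨ solve 3 (λ x y z → x := x :+ con 0 :* y :* z) refl _ (φ (b 4F)) (φ (φ (b 4F))) ⟩
        b 1F * φ (b 1F) * φ (φ (b 3F)) + 0# * φ (b 4F) * φ (φ (b 4F))
          ≡⟨ cong (λ t → b 1F * φ (b 1F) * φ (φ (b 3F)) + t * φ (b 4F) * φ (φ (b 4F))) b₂≡0 ⟨
        b 1F * φ (b 1F) * φ (φ (b 3F)) + b 2F * φ (b 4F) * φ (φ (b 4F))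
          ≡⟨ cubic≡0 ⟩
        0# ∎)
      (*-≢0 (*-≢0 b₁≢0 (X≢0 1F b₁≢0)) (X≢0 2F b₃≢0))
    ... | no b₂≢0 | yes b₃≡0 = contradiction
      (begin
        b 2F * φ (b 4F) * φ (φ (b 4F))
          ≡⟨ solve 2 (λ x y → x := y :* con 0 :+ x) refl _ (b 1F * φ (b 1F)) ⟩
        b 1F * φ (b 1F) * 0# + b 2F * φ (b 4F) * φ (φ (b 4F))
          ≡⟨ cong (λ t → b 1F * φ (b 1F) * t + b 2F * φ (b 4F) * φ (φ (b 4F))) (trans (cong (φ ∘ φ) b₃≡0) φφ-0) ⟨
        b 1F * φ (b 1F) * φ (φ (b 3F)) + b 2F * φ (b 4F) * φ (φ (b 4F))
          ≡⟨ cubic≡0 ⟩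
        0# ∎)
      (*-≢0 (*-≢0 b₂≢0 φb₄≢0) (X≢0 1F φb₄≢0))

  -- Uniqueness of coefficients and closure under composition

  sum-pick : ∀ {n} (k : Fin n) (b : Fin n → Carrier) → sum (λ i → b i * ⟦ i Fin.≟ k ⟧) ≡ b k
  sum-pick {suc n} zero b = trans (cong₂ _+_ (*-identityʳ _)
    (trans (sum-cong-≗ λ i → zeroʳ (b (suc i))) (sum-replicate-zero n))) (+-identityʳ _)
  sum-pick (suc k) b = trans (cong₂ _+_ (zeroʳ _) (sum-pick k (b ∘ suc))) (+-identityˡ _)

  -- The dual functionals recover the coefficients from the function.
  ev-injective : ∀ {b c} → (∀ x → ev b x ≡ ev c x) → ∀ k → b k ≡ c k
  ev-injective {b} {c} e k = trans (sym (pick b)) (trans (K.L-cong e) (pick c))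
    where
    module K = Coefficient k
    pick : ∀ b → K.L (ev b) ≡ b k
    pick b = trans (K.L-sum b X) (trans (sum-cong-≗ λ i → cong (b i *_) (coefficient-X k i)) (sum-pick k b))

  -- Only the existence of coefficients matters for the inverse map and for h: the moments determine
  -- their shape afterwards, so composites need no explicit formula.
  Linearized : (Carrier → Carrier) → Set
  Linearized f = ∃ λ b → ∀ x → f x ≡ ev b x

  linearized-id : Linearized (λ x → x)
  linearized-id = unit , λ x → solve 5 (λ a b c d e → a := con 1 :* a :+ (con 0 :* b :+ (con 0 :* c
    :+ (con 0 :* d :+ (con 0 :* e :+ con 0))))) refl (X 0F x) (X 1F x) (X 2F x) (X 3F x) (X 4F x)

  linearized-0 : Linearized (λ _ → 0#)
  linearized-0 = (λ _ → 0#) , λ x → sym (trans (sum-cong-≗ λ i → zeroˡ (X i x)) (sum-replicate-zero 5))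

  linearized-+ : ∀ {f g} → Linearized f → Linearized g → Linearized (λ x → f x + g x)
  linearized-+ (b , fb) (c , gc) = (λ i → b i + c i) , λ x → sym (trans
    (trans (sum-cong-≗ λ i → distribʳ (X i x) (b i) (c i)) (∑-distrib-+ (λ i → b i * X i x) (λ i → c i * X i x)))
    (sym (cong₂ _+_ (fb x) (gc x))))

  linearized-* : ∀ a {f} → Linearized f → Linearized (λ x → a * f x)
  linearized-* a (b , fb) = (λ i → a * b i) , λ x → trans (cong (a *_) (fb x))
    (trans (*-distribˡ-sum a (λ i → b i * X i x)) (sum-cong-≗ λ i → sym (*-assoc a (b i) (X i x))))

  linearized-φ : ∀ {f} → Linearized f → Linearized (λ x → φ (f x))
  linearized-φ (b , fb) = twist b , λ x → trans (cong φ (fb x)) (sym (ev-twist b x))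

  linearized-sum : ∀ {n} (f : Fin n → Carrier → Carrier) → (∀ i → Linearized (f i)) →
                   Linearized (λ x → sum (λ i → f i x))
  linearized-sum {zero} f lin = linearized-0
  linearized-sum {suc n} f lin = linearized-+ (lin zero) (linearized-sum (f ∘ suc) (lin ∘ suc))

  linearized-X : ∀ i → ∀ {f} → Linearized f → Linearized (λ x → X i (f x))
  linearized-X i {f} lin = go (toℕ i)
    where
    go : ∀ n → Linearized (λ x → iterate n (f x))
    go zero = lin
    go (suc n) = linearized-φ (go n)

  linearized-∘ : ∀ {f g} → Linearized f → Linearized g → Linearized (f ∘ g)
  linearized-∘ {f} {g} (b , fb) lin = proj₁ composite , λ x → trans (fb (g x)) (proj₂ composite x)
    where
    composite : Linearized (λ x → sum (λ i → b i * X i (g x)))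
    composite = linearized-sum (λ i x → b i * X i (g x)) (λ i → linearized-* (b i) (linearized-X i lin))

  linearized-iterate : ∀ {f} → Linearized f → ∀ n → Linearized (λ x → ℕ-fold x f n)
  linearized-iterate lin zero = linearized-id
  linearized-iterate lin (suc n) = linearized-∘ lin (linearized-iterate lin n)

  -- Comparing coefficients in the graph equation

  f₂ : Carrier → Carrier → Carrier
  f₂ δ x = δ * X 2F x + X 3F x

  norm : Carrier → Carrier
  norm x = X 0F x * X 1F x * X 2F x * X 3F x * X 4F x

  module Composition {a b c d δ : Carrier} {v : Fin 5 → Carrier}
    (det≢0 : ¬ a * d + - (b * c) ≡ 0#) (v₁≢0 : ¬ v 1F ≡ 0#)
    (v₀≡0 : v 0F ≡ 0#) (v₂≡0 : v 2F ≡ 0#) (v₃≡0 : v 3F ≡ 0#)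
    (composition : ∀ x → c * x + d * f₂ δ x ≡ ev v (a * x + b * f₂ δ x)) where

    -- Coefficients of the two sides of `composition`. On the right, indices wrap modulo 5: φ⁴ ∘ φ²
    -- = φ and φ⁴ ∘ φ³ = φ².
    left right : Fin 5 → Carrier
    left 0F = c
    left 1F = 0#
    left 2F = d * δ
    left 3F = d
    left 4F = 0#
    right 0F = 0#
    right 1F = v 1F * X 1F a + v 4F * (X 4F b * X 4F δ)
    right 2F = v 4F * X 4F b
    right 3F = v 1F * (X 1F b * X 1F δ)
    right 4F = v 1F * X 1F b + v 4F * X 4F a

    ev-left : ∀ x → ev left x ≡ c * x + d * f₂ δ x
    ev-left x = solve 8 (λ c d δ x₀ x₁ x₂ x₃ x₄ →
      c :* x₀ :+ (con 0 :* x₁ :+ (d :* δ :* x₂ :+ (d :* x₃ :+ (con 0 :* x₄ :+ con 0))))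
      := c :* x₀ :+ d :* (δ :* x₂ :+ x₃)) refl c d δ (X 0F x) (X 1F x) (X 2F x) (X 3F x) (X 4F x)

    X-T : ∀ i x → X i (a * x + b * f₂ δ x)
                ≡ X i a * X i x + X i b * (X i δ * X i (X 2F x) + X i (X 3F x))
    X-T i x = trans (X-+ i _ _) (cong₂ _+_ (X-* i a x)
      (trans (X-* i b _) (cong (X i b *_) (trans (X-+ i _ _) (cong (_+ X i (X 3F x)) (X-* i δ _))))))

    ev-right : ∀ x → ev right x ≡ ev v (a * x + b * f₂ δ x)
    ev-right x = sym (begin
      ev v y
        ≡⟨ cong₂ (λ s t → s * X 0F y + (v 1F * X 1F y + (t * X 2F y + (v 3F * X 3F y + (v 4F * X 4F y + 0#)))))
             v₀≡0 v₂≡0 ⟩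
      0# * X 0F y + (v 1F * X 1F y + (0# * X 2F y + (v 3F * X 3F y + (v 4F * X 4F y + 0#))))
        ≡⟨ cong (λ t → 0# * X 0F y + (v 1F * X 1F y + (0# * X 2F y + (t * X 3F y + (v 4F * X 4F y + 0#))))) v₃≡0 ⟩
      0# * X 0F y + (v 1F * X 1F y + (0# * X 2F y + (0# * X 3F y + (v 4F * X 4F y + 0#))))
        ≡⟨ solve 7 (λ v₁ v₄ y₀ y₁ y₂ y₃ y₄ →
             con 0 :* y₀ :+ (v₁ :* y₁ :+ (con 0 :* y₂ :+ (con 0 :* y₃ :+ (v₄ :* y₄ :+ con 0))))
             := v₁ :* y₁ :+ v₄ :* y₄) refl (v 1F) (v 4F) (X 0F y) (X 1F y) (X 2F y) (X 3F y) (X 4F y) ⟩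
      v 1F * X 1F y + v 4F * X 4F y
        ≡⟨ cong₂ (λ s t → v 1F * s + v 4F * t) (X-T 1F x) (trans (X-T 4F x)
             (cong₂ (λ s t → X 4F a * X 4F x + X 4F b * (X 4F δ * s + t)) (φ-order (φ x)) (φ-order (φ (φ x))))) ⟩
      v 1F * (X 1F a * X 1F x + X 1F b * (X 1F δ * X 3F x + X 4F x))
        + v 4F * (X 4F a * X 4F x + X 4F b * (X 4F δ * X 1F x + X 2F x))
        ≡⟨ solve 13 (λ v₁ v₄ a₁ a₄ b₁ b₄ δ₁ δ₄ x₀ x₁ x₂ x₃ x₄ →
             v₁ :* (a₁ :* x₁ :+ b₁ :* (δ₁ :* x₃ :+ x₄)) :+ v₄ :* (a₄ :* x₄ :+ b₄ :* (δ₄ :* x₁ :+ x₂))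
             := con 0 :* x₀ :+ ((v₁ :* a₁ :+ v₄ :* (b₄ :* δ₄)) :* x₁ :+ (v₄ :* b₄ :* x₂
                :+ (v₁ :* (b₁ :* δ₁) :* x₃ :+ ((v₁ :* b₁ :+ v₄ :* a₄) :* x₄ :+ con 0))))) refl
             (v 1F) (v 4F) (X 1F a) (X 4F a) (X 1F b) (X 4F b) (X 1F δ) (X 4F δ)
             (X 0F x) (X 1F x) (X 2F x) (X 3F x) (X 4F x) ⟩
      ev right x ∎)
      where y = a * x + b * f₂ δ x

    coefficients : ∀ i → left i ≡ right i
    coefficients = ev-injective λ x → trans (ev-left x) (trans (composition x) (sym (ev-right x)))

    -- The coefficient of X₀ gives c = 0, so the determinant is a d.
    d≢0 : ¬ d ≡ 0#
    d≢0 d≡0 = det≢0 (trans (cong₂ (λ s t → a * s + - (b * t)) d≡0 (coefficients 0F))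
      (trans (cong₂ (λ s t → s + - t) (zeroʳ a) (zeroʳ b)) (-‿inverseʳ 0#)))

    v₁φb≢0 : ¬ v 1F * X 1F b ≡ 0#
    v₁φb≢0 e = d≢0 (trans (coefficients 3F) (trans (sym (*-assoc _ _ _)) (trans (cong (_* X 1F δ) e) (zeroˡ _))))

    -- The coefficient of X₁, after v₄ φ⁴(b) is eliminated: it equals d δ by index 2, and d = v₁
    -- φ(b) φ(δ) by index 3. The common factor v₁ then cancels.
    φa : X 1F a + X 1F b * (X 1F δ * δ * X 4F δ) ≡ 0#
    φa = xy≡0⇒y≡0 v₁≢0 (begin
      v 1F * (X 1F a + X 1F b * (X 1F δ * δ * X 4F δ))
        ≡⟨ solve 6 (λ v₁ a₁ b₁ δ₁ δ₀ δ₄ → v₁ :* (a₁ :+ b₁ :* (δ₁ :* δ₀ :* δ₄))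
             := v₁ :* a₁ :+ v₁ :* (b₁ :* δ₁) :* δ₀ :* δ₄) refl (v 1F) (X 1F a) (X 1F b) (X 1F δ) δ (X 4F δ) ⟩
      v 1F * X 1F a + v 1F * (X 1F b * X 1F δ) * δ * X 4F δ
        ≡⟨ cong (λ t → v 1F * X 1F a + t * δ * X 4F δ) (coefficients 3F) ⟨
      v 1F * X 1F a + d * δ * X 4F δ
        ≡⟨ cong (λ t → v 1F * X 1F a + t * X 4F δ) (coefficients 2F) ⟩
      v 1F * X 1F a + v 4F * X 4F b * X 4F δ
        ≡⟨ cong (v 1F * X 1F a +_) (*-assoc _ _ _) ⟩
      right 1F
        ≡⟨ coefficients 1F ⟨
      0# ∎)

    -- Apply φ³ to `φa`; the factor φ⁷(δ) becomes φ²(δ).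
    φ⁴a : X 4F a + X 4F b * (X 4F δ * X 3F δ * X 2F δ) ≡ 0#
    φ⁴a = begin
      X 4F a + X 4F b * (X 4F δ * X 3F δ * X 2F δ)
        ≡⟨ cong (λ t → X 4F a + X 4F b * (X 4F δ * X 3F δ * t)) (φ-order (φ (φ δ))) ⟨
      X 3F (X 1F a) + X 3F (X 1F b) * (X 3F (X 1F δ) * X 3F δ * X 3F (X 4F δ))
        ≡⟨ trans (X-+ 3F _ _) (cong (X 3F (X 1F a) +_) (trans (X-* 3F _ _) (cong (X 3F (X 1F b) *_)
             (trans (X-* 3F _ _) (cong (_* X 3F (X 4F δ)) (X-* 3F _ _)))))) ⟨
      X 3F (X 1F a + X 1F b * (X 1F δ * δ * X 4F δ))
        ≡⟨ trans (cong (X 3F) φa) (X-0 3F) ⟩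
      0# ∎

    -- The coefficient of X₄ says that v₁ φ(b) = -v₄ φ⁴(a). By `φ⁴a` and the coefficients at 2 and
    -- 3, the right side is v₁ φ(b) times all five conjugates of δ: φ⁴(a) contributes the conjugates
    -- 2, 3, 4, and d δ contributes 0 and 1.
    norm≡1 : norm δ ≡ 1#
    norm≡1 = *-cancelˡ v₁φb≢0 (+-cancelʳ (v 4F * X 4F a) _ _ (begin
      v 1F * X 1F b * norm δ + v 4F * X 4F a
        ≡⟨ cong (_+ v 4F * X 4F a) (solve 7 (λ v₁ b₁ δ₀ δ₁ δ₂ δ₃ δ₄ →
             v₁ :* b₁ :* (δ₀ :* δ₁ :* δ₂ :* δ₃ :* δ₄) := v₁ :* (b₁ :* δ₁) :* δ₀ :* (δ₄ :* δ₃ :* δ₂)) refl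
             (v 1F) (X 1F b) δ (X 1F δ) (X 2F δ) (X 3F δ) (X 4F δ)) ⟩
      v 1F * (X 1F b * X 1F δ) * δ * (X 4F δ * X 3F δ * X 2F δ) + v 4F * X 4F a
        ≡⟨ cong (λ t → t * δ * (X 4F δ * X 3F δ * X 2F δ) + v 4F * X 4F a) (coefficients 3F) ⟨
      d * δ * (X 4F δ * X 3F δ * X 2F δ) + v 4F * X 4F a
        ≡⟨ cong (λ t → t * (X 4F δ * X 3F δ * X 2F δ) + v 4F * X 4F a) (coefficients 2F) ⟩
      v 4F * X 4F b * (X 4F δ * X 3F δ * X 2F δ) + v 4F * X 4F a
        ≡⟨ solve 4 (λ v₄ b₄ t a₄ → v₄ :* b₄ :* t :+ v₄ :* a₄ := v₄ :* (a₄ :+ b₄ :* t)) refl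
             (v 4F) (X 4F b) (X 4F δ * X 3F δ * X 2F δ) (X 4F a) ⟩
      v 4F * (X 4F a + X 4F b * (X 4F δ * X 3F δ * X 2F δ))
        ≡⟨ trans (cong (v 4F *_) φ⁴a) (zeroʳ _) ⟩
      0#
        ≡⟨ coefficients 4F ⟩
      v 1F * X 1F b + v 4F * X 4F a
        ≡⟨ cong (_+ v 4F * X 4F a) (*-identityʳ _) ⟨
      v 1F * X 1F b * 1# + v 4F * X 4F a ∎))

theorem5p4 : (p k : ℕ) → Prime p → k ≥ 1 →
    (F : FiniteField) → FiniteField.size F ≡ (p ^ k) ^ 5 →
    (δ : FiniteField.Carrier F) → ¬ (δ ≡ FiniteField.0# F) →
    ¬ (pow F (Norm F (p ^ k) δ) 5 ≡ FiniteField.1# F) →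
    (μ : FiniteField.Carrier F) → ¬ (μ ≡ FiniteField.0# F) →
    ¬ (Norm F (p ^ k) μ ≡ FiniteField.0# F) → ¬ (Norm F (p ^ k) μ ≡ FiniteField.1# F) →
    ¬ PΓL-Equivalent F (g2 F (p ^ k) δ) (g1 F (p ^ k) μ)
theorem5p4 p k p-prime k≥1 F size≡q^5 δ _ Nδ^5≢1 μ μ≢0 _ _ (φ , image-of , onto) = Nδ≢1 Nδ≡1
  where
  open FiniteField F
  open FiniteFieldProperties F
  open PΓL2 φ
  open FieldAut aut
  open ≡-Reasoning

  -- The map x ↦ x^q as an automorphism of order 5

  q : ℕ
  q = p ^ k

  1<q : 1 ℕ.< q
  1<q = ℕ.^-monoʳ-< p (ℕ.nonTrivial⇒n>1 p {{prime⇒nonTrivial p-prime}}) k≥1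

  p⊗1≡0 : p ⊗ 1# ≡ 0#
  p⊗1≡0 = ⊗1-^ p-prime (k ℕ.* 5) (subst (λ n → n ⊗ 1# ≡ 0#) (trans size≡q^5 (ℕ.^-*-assoc p k 5)) size⊗1≡0)

  Frob : Carrier → Carrier
  Frob x = pow F x q

  Frob-iterate : ∀ n x → ℕ-fold x Frob n ≡ pow F x (q ^ n)
  Frob-iterate zero x = sym (*-identityʳ x)
  Frob-iterate (suc n) x = begin
    Frob (ℕ-fold x Frob n)         ≡⟨ cong Frob (Frob-iterate n x) ⟩
    pow F (pow F x (q ^ n)) q      ≡⟨ pow-* x (q ^ n) q ⟨
    pow F x (q ^ n ℕ.* q)          ≡⟨ cong (pow F x) (ℕ.*-comm (q ^ n) q) ⟩
    pow F x (q ^ suc n)            ∎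

  Frob-iterate-distinct : ∀ {m n} → m ℕ.< n → n ℕ.< 5 → ¬ (∀ x → ℕ-fold x Frob m ≡ ℕ-fold x Frob n)
  -- The exponents satisfy q^m < q^n < q^5 = size. The smaller one is passed as a successor, which
  -- makes its positivity immediate.
  Frob-iterate-distinct {m} {n} m<n n<5 e = pow-distinct
    (ℕ.≤-<-trans ℕ.z≤n (ℕ.n<1+n _))
    (subst (ℕ._< q ^ n) (sym (ℕ.suc-pred (q ^ m))) (ℕ.^-monoʳ-< q 1<q m<n))
    (subst (q ^ n ℕ.<_) (sym size≡q^5) (ℕ.^-monoʳ-< q 1<q n<5))
    (λ x → trans (cong (pow F x) (ℕ.suc-pred (q ^ m)))
                 (trans (sym (Frob-iterate m x)) (trans (e x) (Frob-iterate n x))))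
    where instance
      _ = ℕ.>-nonZero (ℕ.<-trans (ℕ.n<1+n 0) 1<q)
      _ = ℕ.m^n≢0 q m

  Frob-distinct : ∀ {i j : Fin 5} → ¬ i ≡ j → ¬ (∀ x → ℕ-fold x Frob (toℕ i) ≡ ℕ-fold x Frob (toℕ j))
  Frob-distinct {i} {j} i≢j e with ℕ.<-cmp (toℕ i) (toℕ j)
  ... | tri< i<j _ _ = Frob-iterate-distinct i<j (Fin.toℕ<n j) e
  ... | tri≈ _ i≡j _ = i≢j (Fin.toℕ-injective i≡j)
  ... | tri> _ _ j<i = Frob-iterate-distinct j<i (Fin.toℕ<n i) (sym ∘ e)

  Frob-order : ∀ x → ℕ-fold x Frob 5 ≡ x
  Frob-order x = trans (Frob-iterate 5 x) (trans (cong (pow F x) (sym size≡q^5)) (pow-size x))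

  Frob-+ : ∀ x y → Frob (x + y) ≡ Frob x + Frob y
  Frob-+ = pow-p^k-+ p-prime p⊗1≡0 k

  Frob-* : ∀ x y → Frob (x * y) ≡ Frob x * Frob y
  Frob-* x y = pow-*-distrib x y q

  Frobenius : AutomorphismOfOrder5 F
  Frobenius = record
    { φ = Frob; φ-+ = Frob-+; φ-* = Frob-*; φ-1 = pow-1 q; φ-order = Frob-order; φ-distinct = Frob-distinct }

  open LinearizedPolynomials F Frobenius

  -- The collineation on the graph of g₂

  σ-0 : σ 0# ≡ 0#
  σ-0 = additive-0 σ-+

  σ≢0 : ∀ {x} → ¬ x ≡ 0# → ¬ σ x ≡ 0#
  σ≢0 x≢0 e = x≢0 (σ-inj (trans e (sym σ-0)))

  σ-pow : ∀ x n → σ (pow F x n) ≡ pow F (σ x) n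
  σ-pow x zero = σ-1
  σ-pow x (suc n) = trans (σ-* x _) (cong (σ x *_) (σ-pow x n))

  f : Carrier → Carrier
  f = f₂ (σ δ)

  σ-g2 : ∀ x → σ (g2 F q δ x) ≡ f (σ x)
  σ-g2 x = begin
    σ (δ * pow F x (q ^ 2) + pow F x (q ^ 3))
      ≡⟨ trans (σ-+ _ _) (cong (_+ σ (pow F x (q ^ 3))) (σ-* _ _)) ⟩
    σ δ * σ (pow F x (q ^ 2)) + σ (pow F x (q ^ 3))
      ≡⟨ cong₂ (λ s t → σ δ * s + t) (σ-pow x (q ^ 2)) (σ-pow x (q ^ 3)) ⟩
    σ δ * pow F (σ x) (q ^ 2) + pow F (σ x) (q ^ 3)
      ≡⟨ cong₂ (λ s t → σ δ * s + t) (Frob-iterate 2 (σ x)) (Frob-iterate 3 (σ x)) ⟨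
    f (σ x) ∎

  g1≡ev : ∀ x → g1 F q μ x ≡ ev (binomial μ) x
  g1≡ev x = begin
    μ * Frob x + pow F x (q ^ 4)
      ≡⟨ cong (μ * Frob x +_) (Frob-iterate 4 x) ⟨
    μ * X 1F x + X 4F x
      ≡⟨ solve 6 (λ m a b c d e →
           m :* b :+ e
           := con 0 :* a :+ (m :* b :+ (con 0 :* c :+ (con 0 :* d :+ (con 1 :* e :+ con 0))))) refl
           μ (X 0F x) (X 1F x) (X 2F x) (X 3F x) (X 4F x) ⟩
    ev (binomial μ) x ∎

  T U : Carrier → Carrier
  T x = a * x + b * f x
  U x = c * x + d * f x

  f-linearized : Linearized f
  f-linearized = linearized-+ (linearized-* (σ δ) (linearized-X 2F linearized-id)) (linearized-X 3F linearized-id)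

  T-linearized : Linearized T
  T-linearized = linearized-+ (linearized-* a linearized-id) (linearized-* b f-linearized)

  U-linearized : Linearized U
  U-linearized = linearized-+ (linearized-* c linearized-id) (linearized-* d f-linearized)

  -- Writing x as σ z absorbs the semilinear part: σ carries the graph of g₂,δ onto the graph of
  -- `f`, on which the matrix acts linearly.
  InL-T : ∀ {x} → ¬ x ≡ 0# → InL F (g1 F q μ) (T x , U x)
  InL-T {x} x≢0 = subst (InL F (g1 F q μ)) (cong₂ _,_ (on a b) (on c d))
    (image-of (z , g2 F q δ z) (z , z≢0 , 1# , 0≢1 ∘ sym , sym (*-identityˡ _) , sym (*-identityˡ _)))
    where
    z = proj₁ (σ-surj x)
    σz≡x : σ z ≡ x
    σz≡x = proj₂ (σ-surj x) refl
    z≢0 : ¬ z ≡ 0#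
    z≢0 e = x≢0 (trans (sym σz≡x) (trans (cong σ e) σ-0))
    on : ∀ s t → s * σ z + t * σ (g2 F q δ z) ≡ s * x + t * f x
    on s t = cong₂ (λ y w → s * y + t * w) σz≡x (trans (σ-g2 z) (cong f σz≡x))

  -- T x is the first coordinate of a vector of L_{g₁,μ}, hence l * y with both factors nonzero:
  -- ⟨(0,1)⟩ is not a point of that set.
  T≢0 : ∀ {x} → ¬ x ≡ 0# → ¬ T x ≡ 0#
  T≢0 x≢0 with InL-T x≢0
  ... | y , y≢0 , l , l≢0 , Tx≡ly , _ = *-≢0 l≢0 y≢0 ∘ trans (sym Tx≡ly)

  linearized-additive : ∀ {g} → Linearized g → Additive g
  linearized-additive (v , g≡ev) x y = trans (g≡ev (x + y)) (trans (ev-+ v x y) (sym (cong₂ _+_ (g≡ev x) (g≡ev y))))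

  T-injective : Injective _≡_ _≡_ T
  T-injective {x} {y} e = x∙y⁻¹≈ε⇒x≈y x y (decidable-stable (x + - y ≟ 0#) λ x-y≢0 → T≢0 x-y≢0
    (+-cancelʳ (T y) _ _ (begin
      T (x + - y) + T y   ≡⟨ linearized-additive T-linearized (x + - y) y ⟨
      T (x + - y + y)     ≡⟨ cong T (trans (+-assoc x (- y) y) (trans (cong (x +_) (-‿inverseˡ y)) (+-identityʳ x))) ⟩
      T x                 ≡⟨ e ⟩
      T y                 ≡⟨ +-identityˡ (T y) ⟨
      0# + T y            ∎)))

  order-1 : ℕ
  order-1 = proj₁ (injective⇒iterate-inverse T-injective)

  -- A power of T, and therefore again linearized.
  T⁻¹ : Carrier → Carrier
  T⁻¹ x = ℕ-fold x T order-1

  T-T⁻¹ : ∀ x → T (T⁻¹ x) ≡ x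
  T-T⁻¹ = proj₂ (injective⇒iterate-inverse T-injective)

  T⁻¹-T : ∀ x → T⁻¹ (T x) ≡ x
  T⁻¹-T x = T-injective (T-T⁻¹ (T x))

  h-linearized : Linearized (λ x → U (T⁻¹ x))
  h-linearized = linearized-∘ U-linearized (linearized-iterate T-linearized order-1)

  -- The slopes of h = U ∘ T⁻¹ and the norm of σ(δ)

  module _ (v : Fin 5 → Carrier) (h≡ev : ∀ x → U (T⁻¹ x) ≡ ev v x) where

    ev-v-T : ∀ x → ev v (T x) ≡ U x
    ev-v-T x = trans (sym (h≡ev (T x))) (cong U (T⁻¹-T x))

    sameSlopes : SameSlopes (ev v) (ev (binomial μ))
    sameSlopes m = mk⇔ forth back
      where
      forth : HasSlope (ev v) m → HasSlope (ev (binomial μ)) m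
      -- The vector of the graph of `f` over T⁻¹ z is sent to (z, h z), which must be a multiple l
      -- of some (y, g₁ y); equal ratios give equal slopes.
      forth (z , z≢0 , e) = point (InL-T {T⁻¹ z} λ x≡0 → z≢0 (trans (sym (T-T⁻¹ z))
                             (trans (cong T x≡0) (additive-0 (linearized-additive T-linearized)))))
        where
        point : InL F (g1 F q μ) (T (T⁻¹ z) , U (T⁻¹ z)) → HasSlope (ev (binomial μ)) m
        point (y , y≢0 , l , l≢0 , Tx≡ly , Ux≡lg1y) = y , y≢0 , *-cancelˡ l≢0 (begin
          l * ev (binomial μ) y   ≡⟨ cong (l *_) (g1≡ev y) ⟨
          l * g1 F q μ y          ≡⟨ Ux≡lg1y ⟨
          U (T⁻¹ z)               ≡⟨ h≡ev z ⟩
          ev v z                  ≡⟨ e ⟩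
          m * z                   ≡⟨ cong (m *_) (T-T⁻¹ z) ⟨
          m * T (T⁻¹ z)           ≡⟨ cong (m *_) Tx≡ly ⟩
          m * (l * y)             ≡⟨ solve 3 (λ m l y → m :* (l :* y) := l :* (m :* y)) refl m l y ⟩
          l * (m * y)             ∎)
      back : HasSlope (ev (binomial μ)) m → HasSlope (ev v) m
      back (y , y≢0 , e) = point (onto (y , g1 F q μ y)
        (y , y≢0 , 1# , 0≢1 ∘ sym , sym (*-identityˡ _) , sym (*-identityˡ _)))
        where
        -- A vector of L_{g₂,δ} is r (x, g₂ x) for some scalar r, and the semilinear action turns r
        -- into σ r, which is cancelled at the end.
        scale : ∀ r x s t → σ r * (s * σ x + t * f (σ x)) ≡ s * σ (r * x) + t * σ (r * g2 F q δ x)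
        scale r x s t = trans
          (solve 5 (λ r s t x f → r :* (s :* x :+ t :* f) := s :* (r :* x) :+ t :* (r :* f)) refl
            (σ r) s t (σ x) (f (σ x)))
          (sym (cong₂ (λ y w → s * y + t * w) (σ-* r x) (trans (σ-* r _) (cong (σ r *_) (σ-g2 x)))))
        point : Σ (Vec2 F) (λ w → InL F (g2 F q δ) w × SamePoint F (act w) (y , g1 F q μ y)) → HasSlope (ev v) m
        point (_ , (x , x≢0 , r , r≢0 , refl , refl) , l , l≢0 , e₁ , e₂) =
          T (σ x) , T≢0 (σ≢0 x≢0) , *-cancelˡ (σ≢0 r≢0) (begin
            σ r * ev v (T (σ x))    ≡⟨ cong (σ r *_) (ev-v-T (σ x)) ⟩
            σ r * U (σ x)           ≡⟨ scale r x c d ⟩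
            c * σ (r * x) + d * σ (r * g2 F q δ x) ≡⟨ e₂ ⟩
            l * g1 F q μ y          ≡⟨ cong (l *_) (trans (g1≡ev y) e) ⟩
            l * (m * y)             ≡⟨ solve 3 (λ m l y → l :* (m :* y) := m :* (l :* y)) refl m l y ⟩
            m * (l * y)             ≡⟨ cong (m *_) e₁ ⟨
            m * (a * σ (r * x) + b * σ (r * g2 F q δ x)) ≡⟨ cong (m *_) (scale r x a b) ⟨
            m * (σ r * T (σ x))     ≡⟨ solve 3 (λ m l y → m :* (l :* y) := l :* (m :* y)) refl m (σ r) (T (σ x)) ⟩
            σ r * (m * T (σ x))     ∎)

    norm≡1 : norm (σ δ) ≡ 1#
    norm≡1 = Composition.norm≡1 {v = v} det≢0 b₁≢0 b₀≡0 (proj₁ b₂≡0×b₃≡0) (proj₂ b₂≡0×b₃≡0) (sym ∘ ev-v-T)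
      where open SlopesOfBinomial {v} {μ} μ≢0 sameSlopes

  Norm≡norm : ∀ x → Norm F q x ≡ norm x
  Norm≡norm x = begin
    pow F x (1 ℕ.+ q ℕ.+ q ^ 2 ℕ.+ q ^ 3 ℕ.+ q ^ 4)
      ≡⟨ trans (pow-+ x (1 ℕ.+ q ℕ.+ q ^ 2 ℕ.+ q ^ 3) (q ^ 4)) (cong (_* pow F x (q ^ 4))
           (trans (pow-+ x (1 ℕ.+ q ℕ.+ q ^ 2) (q ^ 3)) (cong (_* pow F x (q ^ 3)) (pow-+ x (1 ℕ.+ q) (q ^ 2))))) ⟩
    x * Frob x * pow F x (q ^ 2) * pow F x (q ^ 3) * pow F x (q ^ 4)
      ≡⟨ cong₂ _*_ (cong₂ (λ s t → x * Frob x * s * t) (Frob-iterate 2 x) (Frob-iterate 3 x)) (Frob-iterate 4 x) ⟨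
    norm x ∎

  -- The norm is a power with a fixed exponent, so it commutes with σ, and injectivity of σ brings
  -- the equation back to δ.
  Nδ≢1 : ¬ Norm F q (σ δ) ≡ 1#
  Nδ≢1 e = Nδ^5≢1 (trans (cong (λ t → pow F t 5) (σ-inj (trans σ-Norm (trans e (sym σ-1))))) (pow-1 5))
    where
    σ-Norm : σ (Norm F q δ) ≡ Norm F q (σ δ)
    σ-Norm = σ-pow δ (1 ℕ.+ q ℕ.+ q ^ 2 ℕ.+ q ^ 3 ℕ.+ q ^ 4)

  Nδ≡1 : Norm F q (σ δ) ≡ 1#
  Nδ≡1 = trans (Norm≡norm (σ δ)) (norm≡1 (proj₁ h-linearized) (proj₂ h-linearized))
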